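{- Let $W_J$ be a standard parabolic subgroup of a Coxeter group $W$. (i) If $W$ is futuristic, then $W_J$ is futuristic. (ii) If $W_J$ is ancient, then $W$ is ancient.
   Context: Let $(W,S)$ be a Coxeter system with $S=\{s_i:i\in I\}$, $I$ a finite index set; $m(i,i')$ is the order of $s_is_{i'}$. For $J\subseteq I$, the standard parabolic subgroup $W_J$ is the subgroup generated by $\{s_i:i\in J\}$, regarded as a Coxeter group with Coxeter system $(W_J,\{s_i:i\in J\})$. The root space is $V=\mathbb R^I$ with standard basis the simple roots $\{\alpha_i:i\in I\}$ and symmetric bilinear form $B(\alpha_i,\alpha_{i'})=-\cos(\pi/m(i,i'))$ (and $-1$ if $m(i,i')=\infty$). $W$ acts on $V$ by $s_i\beta=\beta-2B(\beta,\alpha_i)\alpha_i$. The root system is $\Phi=\{w\alpha_i:w\in W,i\in I\}=\Phi^+\sqcup\Phi^-$, where $\Phi^+$ are the roots that are nonnegative combinations of simple roots and $\Phi^-=-\Phi^+$. For $\beta\in\Phi$ the half-space $H_\beta^+$ is $\{w\in W:w\beta\in\Phi^+\}$. A subset of $W$ is convex if it is an intersection of half-spaces (the empty intersection being $W$). For a nonempty convex set $\mathscr L\subseteq W$ let $\mathrm R(\mathscr L)=\{\beta\in\Phi:\mathscr L\subseteq H_\beta^+\}$. For $i\in I$, the toggle $\tau_i\colon W\to W$ is defined by $\tau_i(u)=u$ if $u^{ -1}\alpha_i\in\mathrm R(\mathscr L)$ and $\tau_i(u)=s_iu$ otherwise. A Coxeter element is a product $c=s_{i_n}\cdots s_{i_1}$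 where $i_1,\ldots,i_n$ is an ordering of $I$ (each element once); $\mathrm{Pro}_c=\tau_{i_n}\cdots\tau_{i_1}$ (composition), which depends only on $c$ and $\mathscr L$. The set $\mathscr L$ is heavy with respect to $c$ if every periodic point of $\mathrm{Pro}_c$ (i.e. every $u\in W$ with $\mathrm{Pro}_c^K(u)=u$ for some $K\ge 1$) lies in $\mathscr L$. A Coxeter element $c$ is futuristic if every nonempty convex $\mathscr L\subseteq W$ is heavy with respect to $c$. The Coxeter group $W$ is futuristic if all its Coxeter elements are futuristic, and ancient if none of them is. -}

module Defs where

open import Level using (0ℓ)
open import Algebra.Bundles using (CommutativeRing; Group)
import Algebra.Definitions.RawMonoid as RawMonoidDefs
open import Axiom.ExcludedMiddle using (ExcludedMiddle)
open import Data.Bool.Base using (if_then_else_)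
open import Data.Fin.Base using (Fin)
import Data.Fin.Properties as Fin
open import Data.Fin.Subset using (Subset)
open import Data.Fin.Subset.Properties using (_∈?_)
open import Data.List.Base
  using (List; []; _∷_; _++_; allFin; concat; filter; foldl; foldr; length; lookup; replicate)
open import Data.List.Relation.Binary.Permutation.Propositional using (_↭_)
open import Data.Nat.Base as ℕ using (ℕ; zero; suc)
open import Data.Nat.GeneralisedArithmetic using (iterate)
open import Data.Product.Base using (Σ; Σ-syntax; ∃-syntax; _×_; _,_; proj₁; proj₂)
open import Data.Vec.Functional using (Vector)
open import Function.Bundles using (_⇔_)
open import Function.Definitions using (Injective)
open import Relation.Binary.Construct.Closure.Equivalence using (EqClosure)
import Relation.Binary.Construct.NonStrictToStrict as ToStrict
open import Relation.Binary.Core using (Rel)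
open import Relation.Binary.PropositionalEquality.Core using (_≡_; refl; sym; subst; cong)
open import Relation.Binary.Structures using (IsTotalOrder)
open import Relation.Nullary.Decidable.Core using (does)
open import Relation.Nullary.Negation.Core using (¬_)
open import Relation.Unary using (Pred; _⊆_; Satisfiable)

-- The real numbers: a complete ordered field, together with the functions
-- cos and sin and the number π.  The trigonometric fields are Apostol's axioms
-- (Calculus I, §2.5), which together with 0 < π determine cos, sin and π.
-- Classically, any two such structures agree up to isomorphism (and the
-- irrelevant value 0# ⁻¹).
record RealField : Set₁ where
  field
    commutativeRing : CommutativeRing 0ℓ 0ℓ

  open CommutativeRing commutativeRing public
    using (Carrier; _≈_; _+_; _*_; -_; _-_; 0#; 1#; +-rawMonoid)

  infix  4 _≤_
  infix  8 _⁻¹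

  field
    _≤_          : Rel Carrier 0ℓ
    _⁻¹          : Carrier → Carrier
    isTotalOrder : IsTotalOrder _≈_ _≤_
    0≉1          : ¬ 0# ≈ 1#
    ⁻¹-inverseʳ  : ∀ x → ¬ x ≈ 0# → x * x ⁻¹ ≈ 1#
    +-monoʳ-≤    : ∀ x {y z} → y ≤ z → x + y ≤ x + z
    *-nonNeg     : ∀ {x y} → 0# ≤ x → 0# ≤ y → 0# ≤ x * y

  IsUpperBound : Pred Carrier 0ℓ → Pred Carrier 0ℓ
  IsUpperBound P b = ∀ x → P x → x ≤ b

  field
    complete : ∀ (P : Pred Carrier 0ℓ) → Satisfiable P → Satisfiable (IsUpperBound P) →
               ∃[ b ] IsUpperBound P b × (∀ b′ → IsUpperBound P b′ → b ≤ b′)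

  open ToStrict _≈_ _≤_ public using (_<_)
  open RawMonoidDefs +-rawMonoid public using (sum)

  infixl 7 _÷_

  _÷_ : Carrier → ℕ → Carrier
  x ÷ k = x * (RawMonoidDefs._×_ +-rawMonoid k 1#) ⁻¹

  field
    cos sin     : Carrier → Carrier
    π           : Carrier
    cos-cong    : ∀ {x y} → x ≈ y → cos x ≈ cos y
    sin-cong    : ∀ {x y} → x ≈ y → sin x ≈ sin y
    π-positive  : 0# < π
    cos-0       : cos 0# ≈ 1#
    sin-π/2     : sin (π ÷ 2) ≈ 1#
    cos-π       : cos π ≈ - 1#
    cos-diff    : ∀ x y → cos (y - x) ≈ cos y * cos x + sin y * sin x
    cos-pos     : ∀ {x} → 0# < x → x < π ÷ 2 → 0# < cos x
    x*cos<sin   : ∀ {x} → 0# < x → x < π ÷ 2 → x * cos x < sin x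
    sin*cos<x   : ∀ {x} → 0# < x → x < π ÷ 2 → sin x * cos x < x

data ℕ∞ : Set where
  fin : ℕ → ℕ∞
  ∞   : ℕ∞

module _ (G : Group 0ℓ 0ℓ) where
  open Group G using (Carrier; _≈_; _∙_; ε; rawMonoid)

  pow : ℕ → Carrier → Carrier
  pow = RawMonoidDefs._×_ rawMonoid

  HasOrder : Carrier → ℕ∞ → Set
  HasOrder g (fin k) = 1 ℕ.≤ k × pow k g ≈ ε × (∀ j → 1 ℕ.≤ j → pow j g ≈ ε → k ℕ.≤ j)
  HasOrder g ∞       = ∀ j → 1 ℕ.≤ j → ¬ pow j g ≈ ε

-- A group with a finite family of elements and the orders of their pairwise
-- products: all the data from which roots, toggles etc. are built.  Coxeter
-- systems and standard parabolic subgroups both provide such data.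
record MarkedGroup : Set₁ where
  field
    group : Group 0ℓ 0ℓ
    rank  : ℕ

  open Group group public using (Carrier; _≈_; _∙_; ε) renaming (_⁻¹ to inv)

  field
    s       : Fin rank → Carrier
    m       : Fin rank → Fin rank → ℕ∞
    m-order : ∀ i j → HasOrder group (s i ∙ s j) (m i j)

  I : Set
  I = Fin rank

  Word : Set
  Word = List I

  eval : Word → Carrier
  eval = foldr (λ i w → s i ∙ w) ε

-- (W,S) is a Coxeter system: the sᵢ are distinct involutions generating W, and
-- W is presented by the relations (sᵢ sⱼ)^{m(i,j)} = 1 over all i, j with
-- m(i,j) < ∞.  As m(i,i) = 1, these include sᵢ² = 1, so the monoid presentation
-- below is also the group presentation.
module _ (M : MarkedGroup) where
  open MarkedGroup M

  data Step : Rel Word 0ℓ where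
    step : ∀ u v {i j k} → m i j ≡ fin k →
           Step (u ++ concat (replicate k (i ∷ j ∷ [])) ++ v) (u ++ v)

  record IsCoxeterSystem : Set where
    field
      s≉ε        : ∀ i → ¬ s i ≈ ε
      involutive : ∀ i → s i ∙ s i ≈ ε
      distinct   : Injective _≡_ _≈_ s
      generates  : ∀ w → ∃[ a ] eval a ≈ w
      presented  : ∀ a b → eval a ≈ eval b → EqClosure Step a b

record CoxeterSystem : Set₁ where
  field
    markedGroup     : MarkedGroup
    isCoxeterSystem : IsCoxeterSystem markedGroup

  open MarkedGroup markedGroup public
  open IsCoxeterSystem isCoxeterSystem public

module Parabolic (W : CoxeterSystem) (J : Subset (CoxeterSystem.rank W)) where
  open CoxeterSystem W
  private module G = Group group

  elementsJ : List I
  elementsJ = filter (_∈? J) (allFin rank)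

  -- The increasing enumeration of J, by which the index set of W_J is again
  -- of the form Fin k.
  ι : Fin (length elementsJ) → I
  ι = lookup elementsJ

  data ⟨s_J⟩ : Pred Carrier 0ℓ where
    gen     : ∀ j → ⟨s_J⟩ (s (ι j))
    unit    : ⟨s_J⟩ ε
    mul     : ∀ {u v} → ⟨s_J⟩ u → ⟨s_J⟩ v → ⟨s_J⟩ (u ∙ v)
    inverse : ∀ {u} → ⟨s_J⟩ u → ⟨s_J⟩ (G._⁻¹ u)
    resp    : ∀ {u v} → u ≈ v → ⟨s_J⟩ u → ⟨s_J⟩ v

  subgroup : Group 0ℓ 0ℓ
  subgroup = record
    { Carrier = Σ Carrier ⟨s_J⟩
    ; _≈_     = λ u v → proj₁ u ≈ proj₁ v
    ; _∙_     = λ { (u , p) (v , q) → u ∙ v , mul p q }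
    ; ε       = ε , unit
    ; _⁻¹     = λ { (u , p) → G._⁻¹ u , inverse p }
    ; isGroup = record
      { isMonoid = record
        { isSemigroup = record
          { isMagma = record
            { isEquivalence = record { refl = G.refl ; sym = G.sym ; trans = G.trans }
            ; ∙-cong        = G.∙-cong
            }
          ; assoc = λ u v w → G.assoc (proj₁ u) (proj₁ v) (proj₁ w)
          }
        ; identity = (λ u → G.identityˡ (proj₁ u)) , (λ u → G.identityʳ (proj₁ u))
        }
      ; inverse = (λ u → G.inverseˡ (proj₁ u)) , (λ u → G.inverseʳ (proj₁ u))
      ; ⁻¹-cong = G.⁻¹-cong
      }
    }

  private
    pow-proj₁ : ∀ k u → proj₁ (pow subgroup k u) ≡ pow group k (proj₁ u)
    pow-proj₁ zero    u = refl
    pow-proj₁ (suc k) u = cong (proj₁ u ∙_) (pow-proj₁ k u)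

    hasOrder : ∀ u k → HasOrder group (proj₁ u) k → HasOrder subgroup u k
    hasOrder u (fin k) (1≤k , uᵏ≈ε , least) =
        1≤k
      , subst (_≈ ε) (sym (pow-proj₁ k u)) uᵏ≈ε
      , λ j 1≤j uʲ≈ε → least j 1≤j (subst (_≈ ε) (pow-proj₁ j u) uʲ≈ε)
    hasOrder u ∞ infinite j 1≤j uʲ≈ε =
      infinite j 1≤j (subst (_≈ ε) (pow-proj₁ j u) uʲ≈ε)

  parabolic : MarkedGroup
  parabolic = record
    { group   = subgroup
    ; rank    = length elementsJ
    ; s       = λ j → s (ι j) , gen j
    ; m       = λ j j′ → m (ι j) (ι j′)
    ; m-order = λ j j′ → hasOrder _ (m (ι j) (ι j′)) (m-order (ι j) (ι j′))
    }

open Parabolic public using (parabolic)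

module Toggles (em : ExcludedMiddle 0ℓ) (ℝ : RealField) (M : MarkedGroup) where
  open MarkedGroup M
  private module ℝ = RealField ℝ

  V : Set
  V = Vector ℝ.Carrier rank

  _≋_ : Rel V 0ℓ
  β ≋ γ = ∀ i → β i ℝ.≈ γ i

  α : I → V
  α i j = if does (i Fin.≟ j) then ℝ.1# else ℝ.0#

  gram : ℕ∞ → ℝ.Carrier
  gram (fin k) = ℝ.- ℝ.cos (ℝ.π ℝ.÷ k)
  gram ∞       = ℝ.- ℝ.1#

  B : V → V → ℝ.Carrier
  B β γ = ℝ.sum λ i → ℝ.sum λ j → (β i ℝ.* γ j) ℝ.* gram (m i j)

  reflect : I → V → V
  reflect i β j = β j ℝ.- ((ℝ.1# ℝ.+ ℝ.1#) ℝ.* B β (α i)) ℝ.* α i j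

  -- w · β ↦ γ is the graph of the action of W on V: some expression of w as a
  -- product of generators carries β to γ.  In a Coxeter group γ exists and
  -- does not depend on the expression.
  _·_↦_ : Carrier → V → V → Set
  w · β ↦ γ = ∃[ a ] eval a ≈ w × foldr reflect β a ≋ γ

  Φ : Pred V 0ℓ
  Φ β = ∃[ w ] ∃[ i ] w · α i ↦ β

  Φ⁺ : Pred V 0ℓ
  Φ⁺ β = Φ β × (∀ i → ℝ.0# ℝ.≤ β i)

  H⁺ : V → Pred Carrier 0ℓ
  H⁺ β w = ∃[ γ ] (w · β ↦ γ) × Φ⁺ γ

  Convex : Pred Carrier 0ℓ → Set₁
  Convex L = Σ[ P ∈ Pred V 0ℓ ] P ⊆ Φ × (∀ w → L w ⇔ (∀ β → P β → H⁺ β w))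

  R : Pred Carrier 0ℓ → Pred V 0ℓ
  R L β = Φ β × L ⊆ H⁺ β

  τ : Pred Carrier 0ℓ → I → Carrier → Carrier
  τ L i u = if does (em {∃[ β ] (inv u · α i ↦ β) × R L β}) then u else s i ∙ u

  -- The list i₁ , … , iₙ stands for c = s_{iₙ} ⋯ s_{i₁}: the generator s_{i₁},
  -- and likewise the toggle τ_{i₁}, is applied first.
  record IsCoxeterElement (c : Carrier) : Set where
    field
      ordering   : List I
      isOrdering : ordering ↭ allFin rank
      product    : foldl (λ w i → s i ∙ w) ε ordering ≈ c

  open IsCoxeterElement

  -- Pro_c is computed from an ordering that expresses c; it depends on c only.
  Pro : ∀ {c} → IsCoxeterElement c → Pred Carrier 0ℓ → Carrier → Carrier
  Pro o L u = foldl (λ v i → τ L i v) u (ordering o)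

  Periodic : (Carrier → Carrier) → Pred Carrier 0ℓ
  Periodic f u = ∃[ K ] 1 ℕ.≤ K × iterate f u K ≈ u

  Heavy : ∀ {c} → IsCoxeterElement c → Pred Carrier 0ℓ → Set
  Heavy o L = Periodic (Pro o L) ⊆ L

  FuturisticElement : ∀ {c} → IsCoxeterElement c → Set₁
  FuturisticElement o = ∀ L → Satisfiable L → Convex L → Heavy o L

  Futuristic : Set₁
  Futuristic = ∀ c (o : IsCoxeterElement c) → FuturisticElement o

  Ancient : Set₁
  Ancient = ∀ c (o : IsCoxeterElement c) → ¬ FuturisticElement o

{-# OPTIONS --safe #-}
module Submission where

open import Defs
open import Level using (0ℓ)
open import Algebra.Bundles using (CommutativeRing; RawRing; Group)
import Algebra.Properties.AbelianGroup as AbelianGroupProperties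
import Algebra.Properties.CommutativeSemigroup as CommutativeSemigroupProperties
import Algebra.Properties.Group as GroupProperties
import Algebra.Properties.Ring as RingProperties
import Algebra.Properties.Semiring.Mult as SemiringMult
import Algebra.Properties.Semiring.Mult.TCOptimised as SemiringMult′
import Algebra.Properties.Semiring.Sum as SemiringSum
import Algebra.Solver.Ring
open import Algebra.Solver.Ring.AlmostCommutativeRing
  using (fromCommutativeRing; _-Raw-AlmostCommutative⟶_)
import Algebra.Solver.Ring.NaturalCoefficients.Default
open import Axiom.ExcludedMiddle using (ExcludedMiddle)
open import Data.Bool.Base using (true; false; if_then_else_)
open import Data.Fin.Base using (Fin; zero; suc)
import Data.Fin.Properties as Fin
open import Data.Fin.Subset using (Subset) renaming (_∈_ to _∈ˢ_)
open import Data.Fin.Subset.Properties using (_∈?_)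
open import Data.List.Base
  using (List; []; _∷_; [_]; _++_; _∷ʳ_; _∷ʳ′_; allFin; concat; filter; foldl; foldr; initLast;
         length; lookup; map; replicate)
open import Data.List.Membership.Propositional.Properties using (∈-lookup)
open import Data.List.Properties
  using (++-identityʳ; ∷-injective; filter-++; filter-all; filter-none; foldr-++; length-++; map-++;
         map-tabulate; tabulate-lookup)
open import Data.List.Relation.Binary.Permutation.Propositional
  using (_↭_; ↭-refl; ↭-sym; ↭-trans; ↭-reflexive; prep)
open import Data.List.Relation.Binary.Permutation.Propositional.Properties
  using (map⁺; ↭-map-inv; filter-↭; ++⁺ʳ; shift)
open import Data.List.Relation.Unary.All as All using (All; []; _∷_)
open import Data.List.Relation.Unary.All.Properties using (all-filter)
open import Data.List.Relation.Unary.AllPairs using ([]; _∷_)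
open import Data.List.Relation.Unary.Unique.Propositional using (Unique)
open import Data.List.Relation.Unary.Unique.Propositional.Properties using (allFin⁺; filter⁺)
open import Data.Maybe.Base using (Maybe; just; nothing)
open import Data.Nat.Base as ℕ using (ℕ; zero; suc; z≤n; s≤s)
open import Data.Nat.GeneralisedArithmetic using (iterate)
open import Data.Nat.Induction using (<-wellFounded)
import Data.Nat.Properties as ℕ
open import Data.Product.Base using (_×_; _,_; proj₁; proj₂; ∃-syntax)
open import Data.Sum.Base using (_⊎_; inj₁; inj₂)
open import Function.Base using (_∘_)
open import Function.Bundles using (mk⇔; Equivalence)
open import Induction.WellFounded using (Acc; acc)
import Relation.Binary.Construct.Closure.Equivalence as EqClosure
open import Relation.Binary.PropositionalEquality.Core as ≡ using (_≡_; _≢_)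
import Relation.Binary.Reasoning.Setoid as SetoidReasoning
open import Relation.Binary.Structures using (IsTotalOrder; IsEquivalence)
open import Relation.Nullary.Decidable using (yes; no; does; does-⇔)
open import Relation.Nullary.Negation.Core using (¬_; contradiction)
open import Relation.Unary using (Pred; Decidable; _⊆_)
open import Relation.Unary.Properties using (∁?)

-- Let L′ be convex in W_J, and let L be the set of w ∈ W which satisfy the
-- half-space conditions of all roots in R(L′) and of all roots u⁻¹αᵢ with u ∈ W_J
-- and i ∉ J.  The latter roots lie in R(L), so for i ∉ J the toggle τᵢ fixes W_J
-- pointwise, and for i ∈ J it restricts to the toggle of W_J defined by L′.
-- Hence Pro_c restricts on W_J to Pro_c′, where c′ is c without the letters
-- outside J.  Moreover L ∩ W_J = L′, because w u⁻¹αᵢ has αᵢ-coordinate 1 for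
-- w, u ∈ W_J, i ∉ J and a root is either nonnegative or nonpositive.  So if c is
-- futuristic, then so is c′; and every Coxeter element of W_J is such a c′.
--
-- That W acts on V, and that roots have a sign, is proved as usual by computing
-- in the dihedral subgroups (Humphreys, Reflection Groups and Coxeter Groups,
-- §§5.3–5.4), with sin kθ / sin θ given by Chebyshev polynomials.

-- The toggle of W_J consults all of `R L′`, whereas `L` also has elements outside W_J. Imposing the
-- whole of `R L′` on `L`, rather than one family of roots that defines `L′`, puts these roots into
-- `R L` by definition; conversely `L′⊆L` brings a root of `R L` that comes from W_J back into
-- `R L′`. No Coxeter system structure is established on W_J. Its roots and half-spaces are carried
-- into the root space of W by `extend`, and whatever is needed about its action is read off there.
-- Since `w · β ↦ γ` picks some word for w, two statements about the same w may use different words.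
-- Comparing them is what requires that words with equal values act equally. The sign of roots is
-- required for the roots u⁻¹αᵢ with i outside J: they have to be positive on all of `L′`.

-- A ring solver with integer coefficients: the pair (m , n) of natural numbers
-- stands for the integer m - n.
module IntegerSolver (R : CommutativeRing 0ℓ 0ℓ) where
  open CommutativeRing R
  open AbelianGroupProperties +-abelianGroup using (⁻¹-∙-comm; ⁻¹-anti-homo‿-; ε⁻¹≈ε)
  open RingProperties ring using (-‿distribˡ-*; -‿distribʳ-*; -‿involutive)
  open SemiringMult semiring using (×1-homo-*; ×-homo-+) renaming (_×_ to _·_)
  open SemiringMult′ semiring using (×ᵤ≈×) renaming (_×_ to _·′_)
  open Algebra.Solver.Ring.NaturalCoefficients.Default commutativeSemiring
    using (_:+_; _:*_; _:=_) renaming (solve to ℕsolve)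
  open CommutativeSemigroupProperties +-commutativeSemigroup using (interchange)
  open SetoidReasoning setoid

  -- The solver compares coefficients definitionally, so m - n needs a normal form.
  reduce : ℕ → ℕ → ℕ × ℕ
  reduce a b = a ℕ.∸ b , b ℕ.∸ a

  differences : RawRing 0ℓ 0ℓ
  differences = record
    { Carrier = ℕ × ℕ
    ; _≈_     = _≡_
    ; _+_     = λ { (a , b) (c , d) → reduce (a ℕ.+ c) (b ℕ.+ d) }
    ; _*_     = λ { (a , b) (c , d) → reduce (a ℕ.* c ℕ.+ b ℕ.* d) (a ℕ.* d ℕ.+ b ℕ.* c) }
    ; -_      = λ { (a , b) → b , a }
    ; 0#      = 0 , 0
    ; 1#      = 1 , 0
    }

  -- The case b = 0 makes 0 and 1 evaluate to 0# and 1# definitionally.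
  value : ℕ × ℕ → Carrier
  value (a , zero)  = a ·′ 1#
  value (a , suc b) = a · 1# - suc b · 1#

  value≈ : ∀ a b → value (a , b) ≈ a · 1# - b · 1#
  value≈ a zero    = begin
    a ·′ 1#        ≈⟨ ×ᵤ≈× a 1# ⟨
    a · 1#         ≈⟨ +-identityʳ _ ⟨
    a · 1# + 0#    ≈⟨ +-congˡ ε⁻¹≈ε ⟨
    a · 1# - 0#    ∎
  value≈ a (suc b) = refl

  value-reduce : ∀ a b → value (reduce a b) ≈ a · 1# - b · 1#
  value-reduce zero    zero    = value≈ 0 0
  value-reduce zero    (suc b) = value≈ 0 (suc b)
  value-reduce (suc a) zero    = value≈ (suc a) 0
  value-reduce (suc a) (suc b) = begin
    value (reduce a b)                      ≈⟨ value-reduce a b ⟩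
    a · 1# - b · 1#                         ≈⟨ +-identityˡ _ ⟨
    0# + (a · 1# - b · 1#)                  ≈⟨ +-congʳ (-‿inverseʳ 1#) ⟨
    (1# - 1#) + (a · 1# - b · 1#)           ≈⟨ interchange _ _ _ _ ⟩
    suc a · 1# + (- 1# - b · 1#)            ≈⟨ +-congˡ (⁻¹-∙-comm _ _) ⟩
    suc a · 1# - suc b · 1#                 ∎

  homomorphism : differences -Raw-AlmostCommutative⟶ fromCommutativeRing R
  homomorphism = record
    { ⟦_⟧    = value
    ; +-homo = λ { (a , b) (c , d) → begin
        value (reduce (a ℕ.+ c) (b ℕ.+ d))                 ≈⟨ value-reduce (a ℕ.+ c) (b ℕ.+ d) ⟩
        (a ℕ.+ c) · 1# - (b ℕ.+ d) · 1#
          ≈⟨ +-cong (×-homo-+ 1# a c) (-‿cong (×-homo-+ 1# b d)) ⟩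
        (a · 1# + c · 1#) - (b · 1# + d · 1#)              ≈⟨ +-congˡ (⁻¹-∙-comm _ _) ⟨
        (a · 1# + c · 1#) + (- (b · 1#) - d · 1#)          ≈⟨ interchange _ _ _ _ ⟩
        (a · 1# - b · 1#) + (c · 1# - d · 1#)              ≈⟨ +-cong (value≈ a b) (value≈ c d) ⟨
        value (a , b) + value (c , d)                      ∎ }
    ; *-homo = λ { (a , b) (c , d) → begin
        value (reduce (a ℕ.* c ℕ.+ b ℕ.* d) (a ℕ.* d ℕ.+ b ℕ.* c))
          ≈⟨ value-reduce (a ℕ.* c ℕ.+ b ℕ.* d) (a ℕ.* d ℕ.+ b ℕ.* c) ⟩
        (a ℕ.* c ℕ.+ b ℕ.* d) · 1# - (a ℕ.* d ℕ.+ b ℕ.* c) · 1#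
          ≈⟨ +-cong (×1-*+* a c b d) (-‿cong (×1-*+* a d b c)) ⟩
        (a · 1# * c · 1# + b · 1# * d · 1#) - (a · 1# * d · 1# + b · 1# * c · 1#)
          ≈⟨ +-cong (+-congˡ (-‿involutive _)) (⁻¹-∙-comm _ _) ⟨
        (a · 1# * c · 1# - - (b · 1# * d · 1#)) + (- (a · 1# * d · 1#) - b · 1# * c · 1#)
          ≈⟨ +-cong (+-congˡ (trans (-‿cong (-‿distribˡ-* _ _)) (-‿distribʳ-* _ _)))
                     (+-cong (-‿distribʳ-* _ _) (-‿distribˡ-* _ _)) ⟩
        (a · 1# * c · 1# + - (b · 1#) * - (d · 1#)) + (a · 1# * - (d · 1#) + - (b · 1#) * c · 1#)
          ≈⟨ ℕsolve 4 (λ x y z w → (x :* z :+ y :* w) :+ (x :* w :+ y :* z) := (x :+ y) :* (z :+ w)) refl _ _ _ _ ⟩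
        (a · 1# - b · 1#) * (c · 1# - d · 1#)              ≈⟨ *-cong (value≈ a b) (value≈ c d) ⟨
        value (a , b) * value (c , d)                      ∎ }
    ; -‿homo = λ { (a , b) → begin
        value (b , a)            ≈⟨ value≈ b a ⟩
        b · 1# - a · 1#          ≈⟨ ⁻¹-anti-homo‿- _ _ ⟨
        - (a · 1# - b · 1#)      ≈⟨ -‿cong (value≈ a b) ⟨
        - value (a , b)          ∎ }
    ; 0-homo = refl
    ; 1-homo = refl
    }
    where
    ×1-*+* : ∀ a b c d → (a ℕ.* b ℕ.+ c ℕ.* d) · 1# ≈ a · 1# * b · 1# + c · 1# * d · 1#
    ×1-*+* a b c d = trans (×-homo-+ 1# (a ℕ.* b) (c ℕ.* d)) (+-cong (×1-homo-* a b) (×1-homo-* c d))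

  _≟_ : ∀ p q → Maybe (value p ≈ value q)
  (a , b) ≟ (c , d) with a ℕ.+ d ℕ.≟ c ℕ.+ b
  ... | no _        = nothing
  ... | yes a+d≡c+b = just (begin
    value (a , b)                          ≈⟨ value≈ a b ⟩
    a · 1# - b · 1#                        ≈⟨ cancelʳ _ _ _ ⟨
    (a · 1# + d · 1#) - (b · 1# + d · 1#)  ≈⟨ +-congʳ (×-homo-+ 1# a d) ⟨
    (a ℕ.+ d) · 1# - (b · 1# + d · 1#)     ≡⟨ ≡.cong (λ k → k · 1# - (b · 1# + d · 1#)) a+d≡c+b ⟩
    (c ℕ.+ b) · 1# - (b · 1# + d · 1#)     ≈⟨ +-cong (×-homo-+ 1# c b) (-‿cong (+-comm _ _)) ⟩
    (c · 1# + b · 1#) - (d · 1# + b · 1#)  ≈⟨ cancelʳ _ _ _ ⟩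
    c · 1# - d · 1#                        ≈⟨ value≈ c d ⟨
    value (c , d)                          ∎)
    where
    cancelʳ : ∀ x y z → (x + z) - (y + z) ≈ x - y
    cancelʳ x y z = begin
      (x + z) - (y + z)      ≈⟨ +-congˡ (⁻¹-∙-comm y z) ⟨
      (x + z) + (- y - z)    ≈⟨ interchange _ _ _ _ ⟩
      (x - y) + (z - z)      ≈⟨ +-congˡ (-‿inverseʳ z) ⟩
      (x - y) + 0#           ≈⟨ +-identityʳ _ ⟩
      x - y                  ∎

  open Algebra.Solver.Ring differences (fromCommutativeRing R) homomorphism _≟_ public
    using (Polynomial; solve; con; _:+_; _:*_; _:-_; :-_; _:=_)

  -- The constant `𝟚` evaluates definitionally to `1# + 1#`, the factor that occurs in `reflect`.
  𝟘 𝟙 𝟚 : ∀ {n} → Polynomial n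
  𝟘 = con (0 , 0)
  𝟙 = con (1 , 0)
  𝟚 = con (2 , 0)

-- Arithmetic in an ordered field

module Real (ℝ : RealField) where
  open RealField ℝ using (commutativeRing)
  open CommutativeRing commutativeRing public
    renaming (refl to ≈-refl; sym to ≈-sym; trans to ≈-trans; reflexive to ≈-reflexive; zero to *-zero)
  open RealField ℝ public
    using (_≤_; _<_; _⁻¹; isTotalOrder; 0≉1; ⁻¹-inverseʳ; +-monoʳ-≤; *-nonNeg; _÷_;
           cos; sin; π; cos-cong; sin-cong; π-positive; cos-0; sin-π/2; cos-π; cos-diff;
           cos-pos; x*cos<sin)
  open IsTotalOrder isTotalOrder public
    using (total; antisym; ≤-respˡ-≈; ≤-respʳ-≈)
    renaming (reflexive to ≤-reflexive; trans to ≤-trans; refl to ≤-refl)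
  open SemiringMult semiring public using (×-homo-+; ×-assoc-*; ×-congʳ) renaming (_×_ to _·_)
  open IntegerSolver commutativeRing public
    using (solve; 𝟘; 𝟙; 𝟚; _:+_; _:*_; _:-_; :-_; _:=_)
  open SetoidReasoning setoid public

  0≤y-x⇒x≤y : ∀ {x y} → 0# ≤ y - x → x ≤ y
  0≤y-x⇒x≤y {x} {y} 0≤y-x = ≤-respʳ-≈ (solve 2 (λ x y → x :+ (y :- x) := y) ≈-refl x y)
    (≤-respˡ-≈ (+-identityʳ x) (+-monoʳ-≤ x 0≤y-x))

  x≤y⇒0≤y-x : ∀ {x y} → x ≤ y → 0# ≤ y - x
  x≤y⇒0≤y-x {x} {y} x≤y = ≤-respʳ-≈ (+-comm _ _) (≤-respˡ-≈ (-‿inverseˡ x) (+-monoʳ-≤ (- x) x≤y))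

  +-nonNeg : ∀ {x y} → 0# ≤ x → 0# ≤ y → 0# ≤ x + y
  +-nonNeg {x} 0≤x 0≤y = ≤-trans 0≤x (≤-respˡ-≈ (+-identityʳ x) (+-monoʳ-≤ x 0≤y))

  x≤0⇒0≤-x : ∀ {x} → x ≤ 0# → 0# ≤ - x
  x≤0⇒0≤-x x≤0 = ≤-respʳ-≈ (+-identityˡ _) (x≤y⇒0≤y-x x≤0)

  0≤-x⇒x≤0 : ∀ {x} → 0# ≤ - x → x ≤ 0#
  0≤-x⇒x≤0 0≤-x = 0≤y-x⇒x≤y (≤-respʳ-≈ (≈-sym (+-identityˡ _)) 0≤-x)

  0≤1 : 0# ≤ 1#
  0≤1 with total 0# 1#
  ... | inj₁ 0≤1 = 0≤1
  ... | inj₂ 1≤0 = ≤-respʳ-≈ (solve 0 (:- 𝟙 :* :- 𝟙 := 𝟙) ≈-refl)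
                     (*-nonNeg (x≤0⇒0≤-x 1≤0) (x≤0⇒0≤-x 1≤0))

  1≰0 : ¬ 1# ≤ 0#
  1≰0 1≤0 = 0≉1 (antisym 0≤1 1≤0)

  ·-nonNeg : ∀ k {x} → 0# ≤ x → 0# ≤ k · x
  ·-nonNeg zero    0≤x = ≤-refl
  ·-nonNeg (suc k) 0≤x = +-nonNeg 0≤x (·-nonNeg k 0≤x)

  ·-monoˡ-≤ : ∀ {j k x} → 0# ≤ x → j ℕ.≤ k → j · x ≤ k · x
  ·-monoˡ-≤ {k = k} 0≤x z≤n       = ·-nonNeg k 0≤x
  ·-monoˡ-≤         0≤x (s≤s j≤k) = +-monoʳ-≤ _ (·-monoˡ-≤ 0≤x j≤k)

  1+k·1≉0 : ∀ k → ¬ suc k · 1# ≈ 0#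
  1+k·1≉0 k ≈0 = 1≰0 (≤-respʳ-≈ ≈0 (≤-respˡ-≈ (+-identityʳ 1#) (+-monoʳ-≤ 1# (·-nonNeg k 0≤1))))

  *-cancelˡ : ∀ {c x y} → ¬ c ≈ 0# → c * x ≈ c * y → x ≈ y
  *-cancelˡ {c} {x} {y} c≉0 cx≈cy = ≈-trans (≈-sym (c⁻¹cz≈z x)) (≈-trans (*-congˡ cx≈cy) (c⁻¹cz≈z y))
    where
    c⁻¹cz≈z : ∀ z → c ⁻¹ * (c * z) ≈ z
    c⁻¹cz≈z z = begin
      c ⁻¹ * (c * z)  ≈⟨ solve 3 (λ c d z → d :* (c :* z) := (c :* d) :* z) ≈-refl c (c ⁻¹) z ⟩
      (c * c ⁻¹) * z  ≈⟨ *-congʳ (⁻¹-inverseʳ c c≉0) ⟩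
      1# * z          ≈⟨ *-identityˡ z ⟩
      z               ∎

  *-cancelˡ-nonNeg : ∀ {c x} → 0# < c → 0# ≤ c * x → 0# ≤ x
  *-cancelˡ-nonNeg {c} {x} (0≤c , 0≉c) 0≤cx with total 0# x
  ... | inj₁ 0≤x = 0≤x
  ... | inj₂ x≤0 = ≤-reflexive (≈-sym (*-cancelˡ (λ c≈0 → 0≉c (≈-sym c≈0)) cx≈c0))
    where
    cx≈c0 : c * x ≈ c * 0#
    cx≈c0 = ≈-trans (antisym (0≤-x⇒x≤0 (≤-respʳ-≈ (solve 2 (λ c x → c :* :- x := :- (c :* x)) ≈-refl c x)
                                          (*-nonNeg 0≤c (x≤0⇒0≤-x x≤0)))) 0≤cx)
                    (≈-sym (zeroʳ c))

  k·[x÷k]≈x : ∀ k x → suc k · (x ÷ suc k) ≈ x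
  k·[x÷k]≈x k x = begin
    suc k · (x * d)           ≈⟨ ×-congʳ (suc k) (*-identityˡ _) ⟨
    suc k · (1# * (x * d))    ≈⟨ ×-assoc-* (suc k) 1# (x * d) ⟨
    (suc k · 1#) * (x * d)    ≈⟨ solve 3 (λ c d x → c :* (x :* d) := x :* (c :* d)) ≈-refl (suc k · 1#) d x ⟩
    x * ((suc k · 1#) * d)    ≈⟨ *-congˡ (⁻¹-inverseʳ _ (1+k·1≉0 k)) ⟩
    x * 1#                    ≈⟨ *-identityʳ x ⟩
    x                         ∎
    where
    d : Carrier
    d = (suc k · 1#) ⁻¹

  nonNeg-÷ : ∀ k {x} → 0# ≤ x → 0# ≤ x ÷ suc k
  nonNeg-÷ k {x} 0≤x = *-cancelˡ-nonNeg (·-nonNeg (suc k) 0≤1 , λ ≈0 → 1+k·1≉0 k (≈-sym ≈0))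
    (≤-respʳ-≈ (≈-sym [k·1]*[x÷k]≈x) 0≤x)
    where
    [k·1]*[x÷k]≈x : (suc k · 1#) * (x ÷ suc k) ≈ x
    [k·1]*[x÷k]≈x = ≈-trans (×-assoc-* (suc k) 1# _)
                      (≈-trans (×-congʳ (suc k) (*-identityˡ _)) (k·[x÷k]≈x k x))

-- Sine, cosine and Chebyshev polynomials

module Trigonometry (em : ExcludedMiddle 0ℓ) (ℝ : RealField) where
  open Real ℝ

  x²≈0⇒x≈0 : ∀ {x} → x * x ≈ 0# → x ≈ 0#
  x²≈0⇒x≈0 {x} x²≈0 with em {x ≈ 0#}
  ... | yes x≈0 = x≈0
  ... | no  x≉0 = *-cancelˡ x≉0 (≈-trans x²≈0 (≈-sym (zeroʳ x)))

  π/2 : Carrier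
  π/2 = π ÷ 2

  π/2+π/2≈π : π/2 + π/2 ≈ π
  π/2+π/2≈π = ≈-trans (+-congˡ (≈-sym (+-identityʳ _))) (k·[x÷k]≈x 1 π)

  cos²+sin²≈1 : ∀ x → cos x * cos x + sin x * sin x ≈ 1#
  cos²+sin²≈1 x = begin
    cos x * cos x + sin x * sin x  ≈⟨ cos-diff x x ⟨
    cos (x - x)                    ≈⟨ cos-cong (-‿inverseʳ x) ⟩
    cos 0#                         ≈⟨ cos-0 ⟩
    1#                             ∎

  cos²≈1⇒sin≈0 : ∀ {x} → cos x * cos x ≈ 1# → sin x ≈ 0#
  cos²≈1⇒sin≈0 {x} cos²≈1 = x²≈0⇒x≈0 (begin
    sin x * sin x
      ≈⟨ solve 2 (λ c s → s := (c :+ s) :- c) ≈-refl _ _ ⟩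
    (cos x * cos x + sin x * sin x) - cos x * cos x        ≈⟨ +-cong (cos²+sin²≈1 x) (-‿cong cos²≈1) ⟩
    1# - 1#                 ≈⟨ -‿inverseʳ 1# ⟩
    0#                                                     ∎)

  sin²≈1⇒cos≈0 : ∀ {x} → sin x * sin x ≈ 1# → cos x ≈ 0#
  sin²≈1⇒cos≈0 {x} sin²≈1 = x²≈0⇒x≈0 (begin
    cos x * cos x
      ≈⟨ solve 2 (λ c s → c := (c :+ s) :- s) ≈-refl _ _ ⟩
    (cos x * cos x + sin x * sin x) - sin x * sin x        ≈⟨ +-cong (cos²+sin²≈1 x) (-‿cong sin²≈1) ⟩
    1# - 1#                 ≈⟨ -‿inverseʳ 1# ⟩
    0#                                                     ∎)

  sin-0 : sin 0# ≈ 0#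
  sin-0 = cos²≈1⇒sin≈0 (≈-trans (*-cong cos-0 cos-0) (*-identityˡ 1#))

  sin-π : sin π ≈ 0#
  sin-π = cos²≈1⇒sin≈0 (≈-trans (*-cong cos-π cos-π) (solve 0 (:- 𝟙 :* :- 𝟙 := 𝟙) ≈-refl))

  cos-π/2 : cos π/2 ≈ 0#
  cos-π/2 = sin²≈1⇒cos≈0 (≈-trans (*-cong sin-π/2 sin-π/2) (*-identityˡ 1#))

  cos-neg : ∀ x → cos (- x) ≈ cos x
  cos-neg x = begin
    cos (- x)                            ≈⟨ cos-cong (+-identityˡ _) ⟨
    cos (0# - x)                         ≈⟨ cos-diff x 0# ⟩
    cos 0# * cos x + sin 0# * sin x      ≈⟨ +-cong (*-congʳ cos-0) (*-congʳ sin-0) ⟩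
    1# * cos x + 0# * sin x              ≈⟨ solve 2 (λ c s → 𝟙 :* c :+ 𝟘 :* s := c) ≈-refl _ _ ⟩
    cos x                                ∎

  -- The axioms have an addition formula for cosine alone; the shift by π/2 transports it to sine in
  -- `sin-+`.
  cos[π/2-x]≈sin : ∀ x → cos (π/2 - x) ≈ sin x
  cos[π/2-x]≈sin x = begin
    cos (π/2 - x)                        ≈⟨ cos-diff x π/2 ⟩
    cos π/2 * cos x + sin π/2 * sin x    ≈⟨ +-cong (*-congʳ cos-π/2) (*-congʳ sin-π/2) ⟩
    0# * cos x + 1# * sin x              ≈⟨ solve 2 (λ c s → 𝟘 :* c :+ 𝟙 :* s := s) ≈-refl _ _ ⟩
    sin x                                ∎

  sin[π/2-x]≈cos : ∀ x → sin (π/2 - x) ≈ cos x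
  sin[π/2-x]≈cos x = ≈-trans (≈-sym (cos[π/2-x]≈sin (π/2 - x)))
    (cos-cong (solve 2 (λ h x → h :- (h :- x) := x) ≈-refl π/2 x))

  sin-+ : ∀ x y → sin (x + y) ≈ sin x * cos y + cos x * sin y
  sin-+ x y = begin
    sin (x + y)                                      ≈⟨ cos[π/2-x]≈sin (x + y) ⟨
    cos (π/2 - (x + y))
      ≈⟨ cos-cong (solve 3 (λ h x y → h :- (x :+ y) := (h :- x) :- y) ≈-refl π/2 x y) ⟩
    cos ((π/2 - x) - y)                              ≈⟨ cos-diff y (π/2 - x) ⟩
    cos (π/2 - x) * cos y + sin (π/2 - x) * sin y
      ≈⟨ +-cong (*-congʳ (cos[π/2-x]≈sin x)) (*-congʳ (sin[π/2-x]≈cos x)) ⟩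
    sin x * cos y + cos x * sin y                    ∎

  -- The value comes from cos π, because the oddness of sine is itself derived from it in `sin-neg`.
  sin[-π/2] : sin (- π/2) ≈ - 1#
  sin[-π/2] = begin
    sin (- π/2)           ≈⟨ cos[π/2-x]≈sin (- π/2) ⟨
    cos (π/2 - - π/2)     ≈⟨ cos-cong (≈-trans (solve 1 (λ h → h :- :- h := h :+ h) ≈-refl π/2) π/2+π/2≈π) ⟩
    cos π                 ≈⟨ cos-π ⟩
    - 1#                  ∎

  sin-neg : ∀ x → sin (- x) ≈ - sin x
  sin-neg x = begin
    sin (- x)                                      ≈⟨ cos[π/2-x]≈sin (- x) ⟨
    cos (π/2 - - x)
      ≈⟨ cos-cong (solve 2 (λ h x → h :- :- x := x :- :- h) ≈-refl π/2 x) ⟩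
    cos (x - - π/2)                                ≈⟨ cos-diff (- π/2) x ⟩
    cos x * cos (- π/2) + sin x * sin (- π/2)
      ≈⟨ +-cong (*-congˡ (≈-trans (cos-neg π/2) cos-π/2)) (*-congˡ sin[-π/2]) ⟩
    cos x * 0# + sin x * - 1#
      ≈⟨ solve 2 (λ c s → c :* 𝟘 :+ s :* :- 𝟙 := :- s) ≈-refl _ _ ⟩
    - sin x                                        ∎

  sin[π-x]≈sin : ∀ x → sin (π - x) ≈ sin x
  sin[π-x]≈sin x = begin
    sin (π - x)                              ≈⟨ sin-+ π (- x) ⟩
    sin π * cos (- x) + cos π * sin (- x)    ≈⟨ +-cong (*-congʳ sin-π) (*-cong cos-π (sin-neg x)) ⟩
    0# * cos (- x) + - 1# * - sin x          ≈⟨ solve 2 (λ c s → 𝟘 :* c :+ :- 𝟙 :* :- s := s) ≈-refl _ _ ⟩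
    sin x                                    ∎

  sin[x+π]≈-sin : ∀ x → sin (x + π) ≈ - sin x
  sin[x+π]≈-sin x = begin
    sin (x + π)                        ≈⟨ sin-+ x π ⟩
    sin x * cos π + cos x * sin π      ≈⟨ +-cong (*-congˡ cos-π) (*-congˡ sin-π) ⟩
    sin x * - 1# + cos x * 0#          ≈⟨ solve 2 (λ c s → s :* :- 𝟙 :+ c :* 𝟘 := :- s) ≈-refl _ _ ⟩
    - sin x                            ∎

  -- With y = θ + x this is sin(y + θ) + sin(y - θ) = 2 cos θ sin y, the recurrence of the Chebyshev
  -- polynomials.
  sin-recurrence : ∀ θ x → sin (θ + (θ + x)) ≈ (1# + 1#) * cos θ * sin (θ + x) - sin x
  sin-recurrence θ x = begin
    sin (θ + y)                                   ≈⟨ sin-+ θ y ⟩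
    sin θ * cos y + cos θ * sin y
      ≈⟨ solve 4 (λ s c sy cy → s :* cy :+ c :* sy := 𝟚 :* c :* sy :- (:- s :* cy :+ c :* sy))
                 ≈-refl (sin θ) (cos θ) (sin y) (cos y) ⟩
    (1# + 1#) * cos θ * sin y - (- sin θ * cos y + cos θ * sin y)
                   ≈⟨ +-congˡ (-‿cong (+-cong (*-congʳ (sin-neg θ)) (*-congʳ (cos-neg θ)))) ⟨
    (1# + 1#) * cos θ * sin y - (sin (- θ) * cos y + cos (- θ) * sin y)
                   ≈⟨ +-congˡ (-‿cong (sin-+ (- θ) y)) ⟨
    (1# + 1#) * cos θ * sin y - sin (- θ + y)
      ≈⟨ +-congˡ (-‿cong (sin-cong (solve 2 (λ θ x → :- θ :+ (θ :+ x) := x) ≈-refl θ x))) ⟩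
    (1# + 1#) * cos θ * sin y - sin x             ∎
    where
    y : Carrier
    y = θ + x

  -- Strictly below π/2 the cosine is positive and x cos x < sin x; the endpoint is covered by
  -- `sin-π/2`.
  sin-positive : ∀ {x} → 0# < x → x ≤ π/2 → 0# < sin x
  sin-positive {x} 0<x x≤π/2 with em {x ≈ π/2}
  ... | yes x≈π/2 = ≤-respʳ-≈ (≈-sym sinx≈1) 0≤1 , λ 0≈sinx → 0≉1 (≈-trans 0≈sinx sinx≈1)
    where
    sinx≈1 : sin x ≈ 1#
    sinx≈1 = ≈-trans (sin-cong x≈π/2) sin-π/2
  ... | no  x≉π/2 = ≤-trans 0≤xcosx (proj₁ xcosx<sinx) ,
                    λ 0≈sinx → proj₂ xcosx<sinx (antisym (proj₁ xcosx<sinx) (≤-respˡ-≈ 0≈sinx 0≤xcosx))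
    where
    xcosx<sinx : x * cos x < sin x
    xcosx<sinx = x*cos<sin 0<x (x≤π/2 , x≉π/2)
    0≤xcosx : 0# ≤ x * cos x
    0≤xcosx = *-nonNeg (proj₁ 0<x) (proj₁ (cos-pos 0<x (x≤π/2 , x≉π/2)))

  sin-nonNeg-π/2 : ∀ {x} → 0# ≤ x → x ≤ π/2 → 0# ≤ sin x
  sin-nonNeg-π/2 {x} 0≤x x≤π/2 with em {0# ≈ x}
  ... | yes 0≈x = ≤-reflexive (≈-trans (≈-sym sin-0) (sin-cong 0≈x))
  ... | no  0≉x = proj₁ (sin-positive (0≤x , 0≉x) x≤π/2)

  sin-nonNeg : ∀ {x} → 0# ≤ x → x ≤ π → 0# ≤ sin x
  sin-nonNeg {x} 0≤x x≤π with total x π/2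
  ... | inj₁ x≤π/2 = sin-nonNeg-π/2 0≤x x≤π/2
  ... | inj₂ π/2≤x = ≤-respʳ-≈ (sin[π-x]≈sin x) (sin-nonNeg-π/2 (x≤y⇒0≤y-x x≤π)
          (0≤y-x⇒x≤y (≤-respʳ-≈ x-π/2≈π/2-[π-x] (x≤y⇒0≤y-x π/2≤x))))
    where
    x-π/2≈π/2-[π-x] : x - π/2 ≈ π/2 - (π - x)
    x-π/2≈π/2-[π-x] = begin
      x - π/2                  ≈⟨ solve 2 (λ x h → x :- h := h :- ((h :+ h) :- x)) ≈-refl x π/2 ⟩
      π/2 - (π/2 + π/2 - x)    ≈⟨ +-congˡ (-‿cong (+-congʳ π/2+π/2≈π)) ⟩
      π/2 - (π - x)            ∎

  -- The Chebyshev polynomials of the second kind at - g, with the index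
  -- shifted by one: chebyshev (- cos θ) k = sin kθ / sin θ.
  chebyshev : Carrier → ℕ → Carrier
  chebyshev g zero          = 0#
  chebyshev g (suc zero)    = 1#
  chebyshev g (suc (suc k)) = - ((1# + 1#) * g * chebyshev g (suc k)) - chebyshev g k

  -- Both sides satisfy the same three-term recurrence in k. The product form also makes sense where
  -- sin θ vanishes.
  sin*chebyshev : ∀ θ k → sin θ * chebyshev (- cos θ) k ≈ sin (k · θ)
  sin*chebyshev θ zero          = ≈-trans (zeroʳ _) (≈-sym sin-0)
  sin*chebyshev θ (suc zero)    = ≈-trans (*-identityʳ _) (sin-cong (≈-sym (+-identityʳ θ)))
  sin*chebyshev θ (suc (suc k)) = begin
    sin θ * (- ((1# + 1#) * - cos θ * chebyshev g (suc k)) - chebyshev g k)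
      ≈⟨ solve 4 (λ s c u v → s :* (:- (𝟚 :* :- c :* u) :- v) :=
                              𝟚 :* c :* (s :* u) :- s :* v) ≈-refl _ _ _ _ ⟩
    (1# + 1#) * cos θ * (sin θ * chebyshev g (suc k)) - sin θ * chebyshev g k
      ≈⟨ +-cong (*-congˡ (sin*chebyshev θ (suc k))) (-‿cong (sin*chebyshev θ k)) ⟩
    (1# + 1#) * cos θ * sin (θ + k · θ) - sin (k · θ)
      ≈⟨ sin-recurrence θ (k · θ) ⟨
    sin (θ + (θ + k · θ))     ∎
    where
    g : Carrier
    g = - cos θ

  -- The degenerate angle θ = 0, which belongs to m = ∞: the quotient sin kθ / sin θ becomes its
  -- limit k.
  chebyshev[-1]≈k : ∀ k → chebyshev (- 1#) k ≈ k · 1#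
  chebyshev[-1]≈k zero          = ≈-refl
  chebyshev[-1]≈k (suc zero)    = ≈-sym (+-identityʳ 1#)
  chebyshev[-1]≈k (suc (suc k)) = begin
    - ((1# + 1#) * - 1# * chebyshev (- 1#) (suc k)) - chebyshev (- 1#) k
      ≈⟨ +-cong (-‿cong (*-congˡ (chebyshev[-1]≈k (suc k)))) (-‿cong (chebyshev[-1]≈k k)) ⟩
    - ((1# + 1#) * - 1# * (1# + k · 1#)) - k · 1#
      ≈⟨ solve 1 (λ x → :- (𝟚 :* :- 𝟙 :* (𝟙 :+ x)) :- x :=
                        𝟙 :+ (𝟙 :+ x)) ≈-refl (k · 1#) ⟩
    1# + (1# + k · 1#)     ∎

  -- The angle π/m for m ≥ 2

  module _ (k : ℕ) where

    private
      m : ℕ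
      m = suc (suc k)

    θ : Carrier
    θ = π ÷ m

    0≤θ : 0# ≤ θ
    0≤θ = nonNeg-÷ (suc k) (proj₁ π-positive)

    m·θ≈π : m · θ ≈ π
    m·θ≈π = k·[x÷k]≈x (suc k) π

    -- Since m ≥ 2, 2θ ≤ mθ = π. This places θ in the range of `sin-positive`.
    θ≤π/2 : θ ≤ π/2
    θ≤π/2 = 0≤y-x⇒x≤y (*-cancelˡ-nonNeg {1# + 1#} 0<2 (≤-respʳ-≈
      (begin
        m · θ - 2 · θ             ≈⟨ +-cong m·θ≈π ≈-refl ⟩
        π - 2 · θ                 ≈⟨ +-congʳ π/2+π/2≈π ⟨
        (π/2 + π/2) - 2 · θ
          ≈⟨ solve 2 (λ h t → (h :+ h) :- (t :+ (t :+ 𝟘)) := 𝟚 :* (h :- t)) ≈-refl π/2 θ ⟩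
        (1# + 1#) * (π/2 - θ)     ∎)
      (x≤y⇒0≤y-x (·-monoˡ-≤ {2} {m} 0≤θ (s≤s (s≤s z≤n))))))
      where
      0<2 : 0# < 1# + 1#
      0<2 = +-nonNeg 0≤1 0≤1 , λ 0≈2 → 1+k·1≉0 1 (≈-trans (+-congˡ (+-identityʳ 1#)) (≈-sym 0≈2))

    0<sinθ : 0# < sin θ
    0<sinθ = sin-positive (0≤θ , λ 0≈θ → proj₂ π-positive (begin
      0#       ≈⟨ ×-zeroʳ m ⟨
      m · 0#   ≈⟨ ×-congʳ m 0≈θ ⟩
      m · θ    ≈⟨ m·θ≈π ⟩
      π        ∎)) θ≤π/2
      where
      ×-zeroʳ : ∀ k → k · 0# ≈ 0#
      ×-zeroʳ zero    = ≈-refl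
      ×-zeroʳ (suc k) = ≈-trans (+-identityˡ _) (×-zeroʳ k)

    sinθ≉0 : ¬ sin θ ≈ 0#
    sinθ≉0 sinθ≈0 = proj₂ 0<sinθ (≈-sym sinθ≈0)

    -- The angle jθ stays in [0, π]; at j = m + 1 the sign would turn.
    chebyshev-nonNeg : ∀ {j} → j ℕ.≤ m → 0# ≤ chebyshev (- cos θ) j
    chebyshev-nonNeg {j} j≤m = *-cancelˡ-nonNeg 0<sinθ (≤-respʳ-≈ (≈-sym (sin*chebyshev θ j))
      (sin-nonNeg (·-nonNeg j 0≤θ) (≤-respʳ-≈ m·θ≈π (·-monoˡ-≤ 0≤θ j≤m))))

    2m·θ≈π+π : (m ℕ.+ m) · θ ≈ π + π
    2m·θ≈π+π = ≈-trans (×-homo-+ θ m m) (+-cong m·θ≈π m·θ≈π)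

    -- The relator of sᵢ and sⱼ has 2m letters and turns their plane through 2mθ = 2π. The indices
    -- 2m and 2m + 1 therefore give the sines of 0 and θ, up to the factor sin θ.
    chebyshev-2m : chebyshev (- cos θ) (m ℕ.+ m) ≈ 0#
    chebyshev-2m = *-cancelˡ sinθ≉0 (begin
      sin θ * chebyshev (- cos θ) (m ℕ.+ m)   ≈⟨ sin*chebyshev θ (m ℕ.+ m) ⟩
      sin ((m ℕ.+ m) · θ)                     ≈⟨ sin-cong 2m·θ≈π+π ⟩
      sin (π + π)                             ≈⟨ sin[x+π]≈-sin π ⟩
      - sin π                                 ≈⟨ -‿cong sin-π ⟩
      - 0#                                    ≈⟨ solve 1 (λ s → :- 𝟘 := s :* 𝟘) ≈-refl (sin θ) ⟩
      sin θ * 0#                              ∎)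

    chebyshev-1+2m : chebyshev (- cos θ) (suc (m ℕ.+ m)) ≈ 1#
    chebyshev-1+2m = *-cancelˡ sinθ≉0 (begin
      sin θ * chebyshev (- cos θ) (suc (m ℕ.+ m))   ≈⟨ sin*chebyshev θ (suc (m ℕ.+ m)) ⟩
      sin (θ + (m ℕ.+ m) · θ)
        ≈⟨ sin-cong (≈-trans (+-congˡ 2m·θ≈π+π) (≈-sym (+-assoc θ π π))) ⟩
      sin ((θ + π) + π)                             ≈⟨ sin[x+π]≈-sin (θ + π) ⟩
      - sin (θ + π)                                 ≈⟨ -‿cong (sin[x+π]≈-sin θ) ⟩
      - - sin θ                                     ≈⟨ solve 1 (λ s → :- :- s := s :* 𝟙) ≈-refl (sin θ) ⟩
      sin θ * 1#                                    ∎)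

-- Linear algebra of the simple reflections

module Geometry (em : ExcludedMiddle 0ℓ) (ℝ : RealField) (M : MarkedGroup) where
  open Real ℝ
  open MarkedGroup M using (I; Word; m; group; eval)
  open MarkedGroup M using () renaming (_∙_ to infixl 7 _∙_; _≈_ to infix 4 _≈ᵂ_)
  private module G = Group group
  open Toggles em ℝ M public
  open SemiringSum semiring

  act : Word → V → V
  act a β = foldr reflect β a

  -- Linearity is stated for this single operation; multiples and negatives are combinations with
  -- one coefficient `0#`.
  lincomb : Carrier → V → Carrier → V → V
  lincomb x β y γ l = x * β l + y * γ l

  -- This is B(β, αᵢ), with the sum over the coordinates of αᵢ already collapsed.
  pairing : V → I → Carrier
  pairing β i = sum λ k → β k * gram (m k i)

  sum-α : ∀ {n} (i : Fin n) (f : Fin n → Carrier) →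
          sum (λ k → (if does (i Fin.≟ k) then 1# else 0#) * f k) ≈ f i
  sum-α {suc n} zero    f = begin
    1# * f zero + sum (λ k → 0# * f (suc k))
      ≈⟨ +-cong (*-identityˡ _) (≈-trans (sum-cong-≋ (λ k → zeroˡ (f (suc k)))) (sum-replicate-zero n)) ⟩
    f zero + 0#                                ≈⟨ +-identityʳ _ ⟩
    f zero                                     ∎
  sum-α {suc n} (suc i) f = begin
    0# * f zero + sum (λ k → (if does (i Fin.≟ k) then 1# else 0#) * f (suc k))
      ≈⟨ +-cong (zeroˡ _) (sum-α i (f ∘ suc)) ⟩
    0# + f (suc i)                             ≈⟨ +-identityˡ _ ⟩
    f (suc i)                                  ∎

  B-α : ∀ β i → B β (α i) ≈ pairing β i
  B-α β i = sum-cong-≋ λ k → ≈-trans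
    (sum-cong-≋ λ l → solve 3 (λ b a g → b :* a :* g := a :* (b :* g)) ≈-refl (β k) (α i l) (gram (m k l)))
    (sum-α i λ l → β k * gram (m k l))

  pairing-cong : ∀ {β γ} i → β ≋ γ → pairing β i ≈ pairing γ i
  pairing-cong i β≋γ = sum-cong-≋ λ k → *-congʳ (β≋γ k)

  pairing-lincomb : ∀ x β y γ i → pairing (lincomb x β y γ) i ≈ x * pairing β i + y * pairing γ i
  pairing-lincomb x β y γ i = begin
    sum (λ k → (x * β k + y * γ k) * g k)
      ≈⟨ sum-cong-≋ (λ k → solve 5 (λ x b y c g → (x :* b :+ y :* c) :* g := x :* (b :* g) :+ y :* (c :* g))
                                   ≈-refl x (β k) y (γ k) (g k)) ⟩
    sum (λ k → x * (β k * g k) + y * (γ k * g k))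
      ≈⟨ ∑-distrib-+ (λ k → x * (β k * g k)) (λ k → y * (γ k * g k)) ⟩
    sum (λ k → x * (β k * g k)) + sum (λ k → y * (γ k * g k))
      ≈⟨ +-cong (*-distribˡ-sum x λ k → β k * g k) (*-distribˡ-sum y λ k → γ k * g k) ⟨
    x * pairing β i + y * pairing γ i   ∎
    where
    g : I → Carrier
    g k = gram (m k i)

  pairing-α : ∀ j i → pairing (α j) i ≈ gram (m j i)
  pairing-α j i = sum-α j λ k → gram (m k i)

  reflect≈ : ∀ i β l → reflect i β l ≈ β l - (1# + 1#) * pairing β i * α i l
  reflect≈ i β l = +-congˡ (-‿cong (*-congʳ (*-congˡ (B-α β i))))

  reflect-cong : ∀ i {β γ} → β ≋ γ → reflect i β ≋ reflect i γ
  reflect-cong i {β} {γ} β≋γ l = begin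
    reflect i β l                               ≈⟨ reflect≈ i β l ⟩
    β l - (1# + 1#) * pairing β i * α i l
      ≈⟨ +-cong (β≋γ l) (-‿cong (*-congʳ (*-congˡ (pairing-cong i β≋γ)))) ⟩
    γ l - (1# + 1#) * pairing γ i * α i l       ≈⟨ reflect≈ i γ l ⟨
    reflect i γ l                               ∎

  reflect-lincomb : ∀ i x β y γ → reflect i (lincomb x β y γ) ≋ lincomb x (reflect i β) y (reflect i γ)
  reflect-lincomb i x β y γ l = begin
    reflect i (lincomb x β y γ) l
      ≈⟨ reflect≈ i (lincomb x β y γ) l ⟩
    (x * β l + y * γ l) - (1# + 1#) * pairing (lincomb x β y γ) i * α i l
      ≈⟨ +-congˡ (-‿cong (*-congʳ (*-congˡ (pairing-lincomb x β y γ i)))) ⟩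
    (x * β l + y * γ l) - (1# + 1#) * (x * pairing β i + y * pairing γ i) * α i l
      ≈⟨ solve 7 (λ x b y c p q a → (x :* b :+ y :* c) :- 𝟚 :* (x :* p :+ y :* q) :* a :=
                    x :* (b :- 𝟚 :* p :* a) :+ y :* (c :- 𝟚 :* q :* a))
           ≈-refl x (β l) y (γ l) (pairing β i) (pairing γ i) (α i l) ⟩
    x * (β l - (1# + 1#) * pairing β i * α i l) + y * (γ l - (1# + 1#) * pairing γ i * α i l)
      ≈⟨ +-cong (*-congˡ (reflect≈ i β l)) (*-congˡ (reflect≈ i γ l)) ⟨
    x * reflect i β l + y * reflect i γ l   ∎

  reflect-fixes : ∀ i {β} → pairing β i ≈ 0# → reflect i β ≋ β
  reflect-fixes i {β} ⊥αᵢ l = begin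
    reflect i β l                             ≈⟨ reflect≈ i β l ⟩
    β l - (1# + 1#) * pairing β i * α i l     ≈⟨ +-congˡ (-‿cong (*-congʳ (*-congˡ ⊥αᵢ))) ⟩
    β l - (1# + 1#) * 0# * α i l
      ≈⟨ solve 2 (λ b a → b :- 𝟚 :* 𝟘 :* a := b) ≈-refl (β l) (α i l) ⟩
    β l                                       ∎

  ≋-refl : ∀ {β} → β ≋ β
  ≋-refl l = ≈-refl

  ≋-sym : ∀ {β γ} → β ≋ γ → γ ≋ β
  ≋-sym β≋γ l = ≈-sym (β≋γ l)

  ≋-trans : ∀ {β γ δ} → β ≋ γ → γ ≋ δ → β ≋ δ
  ≋-trans β≋γ γ≋δ l = ≈-trans (β≋γ l) (γ≋δ l)

  ≋-reflexive : ∀ {β γ} → β ≡ γ → β ≋ γ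
  ≋-reflexive ≡.refl = ≋-refl

  lincomb-cong : ∀ x {β β′} y {γ γ′} → β ≋ β′ → γ ≋ γ′ → lincomb x β y γ ≋ lincomb x β′ y γ′
  lincomb-cong x y β≋β′ γ≋γ′ l = +-cong (*-congˡ (β≋β′ l)) (*-congˡ (γ≋γ′ l))

  act-++ : ∀ a b β → act (a ++ b) β ≡ act a (act b β)
  act-++ a b β = foldr-++ reflect β a b

  act-cong : ∀ a {β γ} → β ≋ γ → act a β ≋ act a γ
  act-cong []      β≋γ = β≋γ
  act-cong (i ∷ a) β≋γ = reflect-cong i (act-cong a β≋γ)

  act-lincomb : ∀ a x β y γ → act a (lincomb x β y γ) ≋ lincomb x (act a β) y (act a γ)
  act-lincomb []      x β y γ = ≋-refl
  act-lincomb (i ∷ a) x β y γ = ≋-trans (reflect-cong i (act-lincomb a x β y γ)) (reflect-lincomb i x (act a β) y (act a γ))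

  NonNeg : V → Set
  NonNeg β = ∀ i → 0# ≤ β i

  NonNeg-resp : ∀ {β γ} → β ≋ γ → NonNeg β → NonNeg γ
  NonNeg-resp β≋γ 0≤β i = ≤-respʳ-≈ (β≋γ i) (0≤β i)

  α-nonNeg : ∀ i → NonNeg (α i)
  α-nonNeg i j with does (i Fin.≟ j)
  ... | true  = 0≤1
  ... | false = ≤-refl

  eval-++ : ∀ a b → eval (a ++ b) ≈ᵂ eval a ∙ eval b
  eval-++ []      b = G.sym (G.identityˡ _)
  eval-++ (i ∷ a) b = G.trans (G.∙-congˡ (eval-++ a b)) (G.sym (G.assoc _ _ _))

  Φ-resp : ∀ {β γ} → β ≋ γ → Φ β → Φ γ
  Φ-resp β≋γ (w , i , a , a≈w , aαᵢ≋β) = w , i , a , a≈w , ≋-trans aαᵢ≋β β≋γ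

  Φ-act : ∀ a {β} → Φ β → Φ (act a β)
  Φ-act a {β} (w , i , b , b≈w , bαᵢ≋β) =
    eval (a ++ b) , i , a ++ b , G.refl , ≋-trans (≋-reflexive (act-++ a b (α i))) (act-cong a bαᵢ≋β)

  H⁺-intro : ∀ {a w β} → eval a ≈ᵂ w → Φ β → NonNeg (act a β) → H⁺ β w
  H⁺-intro {a} {β = β} a≈w Φβ 0≤aβ = act a β , (a , a≈w , ≋-refl) , Φ-act a Φβ , 0≤aβ

-- The action of W on the root space

module CoxeterGeometry (em : ExcludedMiddle 0ℓ) (ℝ : RealField) (W : CoxeterSystem) where
  open Real ℝ
  open Trigonometry em ℝ
  module W = CoxeterSystem W
  module G = Group W.group
  open W using (I; Word; m; m-order; s; eval)
  open Geometry em ℝ W.markedGroup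
  open MarkedGroup W.markedGroup using () renaming (_∙_ to infixl 7 _∙_; _≈_ to infix 4 _≈ᵂ_)

  pow-∙-swap : ∀ k x y → pow W.group k (y ∙ x) ∙ y ≈ᵂ y ∙ pow W.group k (x ∙ y)
  pow-∙-swap zero    x y = G.trans (G.identityˡ y) (G.sym (G.identityʳ y))
  pow-∙-swap (suc k) x y = R.begin
    y ∙ x ∙ pow W.group k (y ∙ x) ∙ y      R.≈⟨ G.assoc _ _ _ ⟩
    y ∙ x ∙ (pow W.group k (y ∙ x) ∙ y)    R.≈⟨ G.∙-congˡ (pow-∙-swap k x y) ⟩
    y ∙ x ∙ (y ∙ pow W.group k (x ∙ y))    R.≈⟨ G.assoc _ _ _ ⟩
    y ∙ (x ∙ (y ∙ pow W.group k (x ∙ y)))  R.≈⟨ G.∙-congˡ (G.assoc _ _ _) ⟨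
    y ∙ (x ∙ y ∙ pow W.group k (x ∙ y))    R.∎
    where module R = SetoidReasoning G.setoid

  pow-swap : ∀ k x y → pow W.group k (x ∙ y) ≈ᵂ W.ε → pow W.group k (y ∙ x) ≈ᵂ W.ε
  pow-swap k x y xyᵏ≈ε = identityˡ-unique _ y
    (G.trans (pow-∙-swap k x y) (G.trans (G.∙-congˡ xyᵏ≈ε) (G.identityʳ y)))
    where open import Algebra.Properties.Group W.group using (identityˡ-unique)

  HasOrder-unique : ∀ {g h} → (∀ k → pow W.group k g ≈ᵂ W.ε → pow W.group k h ≈ᵂ W.ε) →
                    (∀ k → pow W.group k h ≈ᵂ W.ε → pow W.group k g ≈ᵂ W.ε) →
                    ∀ {a b} → HasOrder W.group g a → HasOrder W.group h b → a ≡ b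
  HasOrder-unique g⇒h h⇒g {fin j} {fin k} (1≤j , gʲ≈ε , j-least) (1≤k , hᵏ≈ε , k-least) =
    ≡.cong fin (ℕ.≤-antisym (j-least k 1≤k (h⇒g k hᵏ≈ε)) (k-least j 1≤j (g⇒h j gʲ≈ε)))
  HasOrder-unique g⇒h h⇒g {fin j} {∞} (1≤j , gʲ≈ε , _) h∞ = contradiction (g⇒h j gʲ≈ε) (h∞ j 1≤j)
  HasOrder-unique g⇒h h⇒g {∞} {fin k} g∞ (1≤k , hᵏ≈ε , _) = contradiction (h⇒g k hᵏ≈ε) (g∞ k 1≤k)
  HasOrder-unique g⇒h h⇒g {∞} {∞} _ _ = ≡.refl

  -- Only orders of products are given, so symmetry has to be derived: sᵢsⱼ and sⱼsᵢ are conjugate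
  -- and are killed by the same exponents.
  m-sym : ∀ i j → m i j ≡ m j i
  m-sym i j = HasOrder-unique (λ k → pow-swap k (s i) (s j)) (λ k → pow-swap k (s j) (s i))
                (m-order i j) (m-order j i)

  m-diagonal : ∀ i → m i i ≡ fin 1
  m-diagonal i = HasOrder-unique (λ k p → p) (λ k p → p) (m-order i i)
    (s≤s z≤n , G.trans (G.identityʳ _) (W.involutive i) , λ j 1≤j _ → 1≤j)

  -- Exponent 1 would give sᵢ = sⱼ, against the distinctness of the generators.
  2≤m : ∀ {i j k} → i ≢ j → m i j ≡ fin k → 2 ℕ.≤ k
  2≤m {i} {j} {k} i≢j mᵢⱼ≡k with k | ≡.subst (HasOrder W.group (s i ∙ s j)) mᵢⱼ≡k (m-order i j)
  ... | zero        | () , _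
  ... | suc (suc k) | _ = s≤s (s≤s z≤n)
  ... | suc zero    | _ , sᵢsⱼ≈ε , _ = contradiction (W.distinct (R.begin
    s i              R.≈⟨ G.identityʳ _ ⟨
    s i ∙ W.ε        R.≈⟨ G.∙-congˡ (W.involutive j) ⟨
    s i ∙ (s j ∙ s j)  R.≈⟨ G.assoc _ _ _ ⟨
    s i ∙ s j ∙ s j  R.≈⟨ G.∙-congʳ (G.trans (G.sym (G.identityʳ _)) sᵢsⱼ≈ε) ⟩
    W.ε ∙ s j        R.≈⟨ G.identityˡ _ ⟩
    s j              R.∎)) i≢j
    where module R = SetoidReasoning G.setoid

  gram-diagonal : ∀ i → gram (m i i) ≈ 1#
  gram-diagonal i = begin
    gram (m i i)        ≡⟨ ≡.cong gram (m-diagonal i) ⟩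
    - cos (π ÷ 1)       ≈⟨ -‿cong (cos-cong (≈-trans (≈-sym (+-identityʳ _)) (k·[x÷k]≈x 0 π))) ⟩
    - cos π             ≈⟨ -‿cong cos-π ⟩
    - - 1#              ≈⟨ solve 0 (:- :- 𝟙 := 𝟙) ≈-refl ⟩
    1#                  ∎

  reflect-α : ∀ i j l → reflect i (α j) l ≈ α j l - (1# + 1#) * gram (m j i) * α i l
  reflect-α i j l = ≈-trans (reflect≈ i (α j) l) (+-congˡ (-‿cong (*-congʳ (*-congˡ (pairing-α j i)))))

  -- Only the coefficient of αᵢ changes, and it changes by one step of the Chebyshev recurrence. So
  -- a word in two letters acts on pairs of consecutive Chebyshev values.
  reflect-lincomb-α : ∀ i j x y → reflect i (lincomb x (α i) y (α j)) ≋
                      lincomb (- x - (1# + 1#) * gram (m j i) * y) (α i) y (α j)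
  reflect-lincomb-α i j x y l = begin
    reflect i (lincomb x (α i) y (α j)) l
      ≈⟨ reflect-lincomb i x (α i) y (α j) l ⟩
    x * reflect i (α i) l + y * reflect i (α j) l
      ≈⟨ +-cong (*-congˡ (≈-trans (reflect-α i i l) (+-congˡ (-‿cong (*-congʳ (*-congˡ (gram-diagonal i)))))))
                (*-congˡ (reflect-α i j l)) ⟩
    x * (α i l - (1# + 1#) * 1# * α i l) + y * (α j l - (1# + 1#) * g * α i l)
      ≈⟨ solve 5 (λ x y g a b →
           x :* (a :- 𝟚 :* 𝟙 :* a) :+ y :* (b :- 𝟚 :* g :* a) :=
           (:- x :- 𝟚 :* g :* y) :* a :+ y :* b) ≈-refl x y g (α i l) (α j l) ⟩
    (- x - (1# + 1#) * g * y) * α i l + y * α j l   ∎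
    where
    g : Carrier
    g = gram (m j i)

  reflect-reflect : ∀ i β → reflect i (reflect i β) ≋ β
  reflect-reflect i β l = begin
    reflect i (reflect i β) l
      ≈⟨ reflect-cong i (λ l → ≈-trans (reflect≈ i β l) (+-cong (≈-sym (*-identityˡ _)) (-‿distribˡ-* _ _))) l ⟩
    reflect i (lincomb 1# β (- 2p) (α i)) l
      ≈⟨ reflect-lincomb i 1# β (- 2p) (α i) l ⟩
    1# * reflect i β l + - 2p * reflect i (α i) l
      ≈⟨ +-cong (*-congˡ (reflect≈ i β l))
                (*-congˡ (≈-trans (reflect-α i i l) (+-congˡ (-‿cong (*-congʳ (*-congˡ (gram-diagonal i))))))) ⟩
    1# * (β l - 2p * α i l) + - 2p * (α i l - (1# + 1#) * 1# * α i l)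
      ≈⟨ solve 3 (λ b p a → 𝟙 :* (b :- p :* a) :+ :- p :* (a :- 𝟚 :* 𝟙 :* a) := b)
           ≈-refl (β l) 2p (α i l) ⟩
    β l   ∎
    where
    open import Algebra.Properties.Ring ring using (-‿distribˡ-*)
    2p : Carrier
    2p = (1# + 1#) * pairing β i

  alternating : I → I → ℕ → Word
  alternating p q zero    = []
  alternating p q (suc k) = p ∷ alternating q p k

  lincomb-swap : ∀ x β y γ → lincomb x β y γ ≋ lincomb y γ x β
  lincomb-swap x β y γ l = +-comm _ _

  -- Describing r as the letter that continues the word avoids a case split on
  -- the parity of k.
  act-alternating : ∀ {p q r} k → alternating p q (suc k) ≡ alternating p q k ∷ʳ r →
    act (alternating p q k) (α r) ≋
      lincomb (chebyshev (gram (m p q)) (suc k)) (α p) (chebyshev (gram (m p q)) k) (α q)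
  act-alternating {p} {q} zero ≡.refl l = solve 2 (λ a b → a := 𝟙 :* a :+ 𝟘 :* b) ≈-refl (α p l) (α q l)
  act-alternating {p} {q} {r} (suc k) eq = ≋-trans
    -- The tail alternates from q, so its expansion is swapped to put αₚ first before the reflection
    -- in αₚ.
    (reflect-cong p (≋-trans (act-alternating k (proj₂ (∷-injective eq))) (lincomb-swap _ (α q) _ (α p))))
    (≋-trans (reflect-lincomb-α p q _ _) λ l → +-cong (*-congʳ coefficient)
        (*-congʳ (≈-reflexive (≡.cong (λ n → chebyshev (gram n) (suc k)) (m-sym q p)))))
    where
    coefficient : - chebyshev (gram (m q p)) k - (1# + 1#) * gram (m q p) * chebyshev (gram (m q p)) (suc k) ≈
                  chebyshev (gram (m p q)) (suc (suc k))
    coefficient = ≈-trans (+-comm _ _) (≈-reflexive (≡.cong (λ n → chebyshev (gram n) (suc (suc k))) (m-sym q p)))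

  relator : I → I → ℕ → Word
  relator i j k = concat (replicate k (i ∷ j ∷ []))

  module _ (i j : I) where

    private
      gᵢⱼ : Carrier
      gᵢⱼ = gram (m i j)

      U : ℕ → Carrier
      U = chebyshev gᵢⱼ

    act-relator-αᵢ : ∀ k → act (relator i j k) (α i) ≋ lincomb (U (suc (k ℕ.+ k))) (α i) (U (k ℕ.+ k)) (α j)
    -- The coefficient of αⱼ is minus the Chebyshev value of index 2k - 1, rewritten by the
    -- recurrence so that no negative index occurs at k = 0.
    act-relator-αⱼ : ∀ k → act (relator i j k) (α j) ≋
      lincomb (- U (k ℕ.+ k)) (α i) (U (suc (k ℕ.+ k)) + (1# + 1#) * gᵢⱼ * U (k ℕ.+ k)) (α j)

    reflectᵢⱼ : ∀ x y → reflect i (reflect j (lincomb x (α i) y (α j))) ≋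
      lincomb (- x - (1# + 1#) * gᵢⱼ * (- y - (1# + 1#) * gᵢⱼ * x)) (α i) (- y - (1# + 1#) * gᵢⱼ * x) (α j)
    reflectᵢⱼ x y = ≋-trans (reflect-cong i (≋-trans (reflect-cong j (lincomb-swap x (α i) y (α j)))
      (≋-trans (reflect-lincomb-α j i y x) (lincomb-swap _ (α j) x (α i)))))
      (≋-trans (reflect-lincomb-α i j x _) λ l →
        +-congʳ (*-congʳ (+-congˡ (-‿cong (*-congʳ (*-congˡ (≈-reflexive (≡.cong gram (m-sym j i)))))))))

    act-relator-αᵢ zero l = solve 2 (λ a b → a := 𝟙 :* a :+ 𝟘 :* b) ≈-refl (α i l) (α j l)
    act-relator-αᵢ (suc k) rewrite ℕ.+-suc k k = ≋-trans (reflect-cong i (reflect-cong j (act-relator-αᵢ k)))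
      (≋-trans (reflectᵢⱼ _ _) λ l → +-cong
        (*-congʳ (solve 3 (λ g u v → :- u :- 𝟚 :* g :* (:- v :- 𝟚 :* g :* u) :=
                                     :- (𝟚 :* g :* (:- (𝟚 :* g :* u) :- v)) :- u)
                   ≈-refl gᵢⱼ (U (suc (k ℕ.+ k))) (U (k ℕ.+ k))))
        (*-congʳ (+-comm _ _)))

    act-relator-αⱼ zero l = solve 3 (λ a b g → b := :- 𝟘 :* a :+ (𝟙 :+ 𝟚 :* g :* 𝟘) :* b) ≈-refl (α i l) (α j l) gᵢⱼ
    act-relator-αⱼ (suc k) rewrite ℕ.+-suc k k = ≋-trans (reflect-cong i (reflect-cong j (act-relator-αⱼ k)))
      (≋-trans (reflectᵢⱼ _ _) λ l → +-cong
        (*-congʳ (solve 3 (λ g u v → :- (:- v) :- 𝟚 :* g :* (:- (u :+ 𝟚 :* g :* v) :- 𝟚 :* g :* (:- v)) :=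
                                     :- (:- (𝟚 :* g :* u) :- v))
                   ≈-refl gᵢⱼ (U (suc (k ℕ.+ k))) (U (k ℕ.+ k))))
        (*-congʳ (solve 3 (λ g u v → :- (u :+ 𝟚 :* g :* v) :- 𝟚 :* g :* (:- v) :=
                                     (:- (𝟚 :* g :* (:- (𝟚 :* g :* u) :- v)) :- u)
                                     :+ 𝟚 :* g :* (:- (𝟚 :* g :* u) :- v))
                   ≈-refl gᵢⱼ (U (suc (k ℕ.+ k))) (U (k ℕ.+ k)))))

  sin≉0⇒1-gram²≉0 : ∀ {x} → ¬ sin x ≈ 0# → ¬ 1# - (- cos x) * (- cos x) ≈ 0#
  sin≉0⇒1-gram²≉0 {x} sinx≉0 ≈0 = sinx≉0 (x²≈0⇒x≈0 (begin
    sin x * sin x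
      ≈⟨ solve 2 (λ c s → s :* s := (c :* c :+ s :* s) :- (:- c) :* (:- c)) ≈-refl (cos x) (sin x) ⟩
    cos x * cos x + sin x * sin x - (- cos x) * (- cos x)      ≈⟨ +-congʳ (cos²+sin²≈1 x) ⟩
    1# - (- cos x) * (- cos x)                                 ≈⟨ ≈0 ⟩
    0#                                                         ∎))

  act-relator-fixes : ∀ {i j β} k → pairing β i ≈ 0# → pairing β j ≈ 0# → act (relator i j k) β ≋ β
  act-relator-fixes         zero    ⊥αᵢ ⊥αⱼ = ≋-refl
  act-relator-fixes {i} {j} (suc k) ⊥αᵢ ⊥αⱼ = ≋-trans
    (reflect-cong i (≋-trans (reflect-cong j (act-relator-fixes k ⊥αᵢ ⊥αⱼ)) (reflect-fixes j ⊥αⱼ)))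
    (reflect-fixes i ⊥αᵢ)

  -- For i ≠ j the plane of αᵢ and αⱼ is nondegenerate, and its orthogonal
  -- complement is fixed by both reflections.
  act-relator : ∀ {i j k} β → m i j ≡ fin k → act (relator i j k) β ≋ β
  act-relator {i} {j} {k} β mᵢⱼ≡k with i Fin.≟ j
  -- Here the exponent is 1 and the relator is sᵢsᵢ.
  ... | yes ≡.refl with ≡.refl ← ≡.trans (≡.sym mᵢⱼ≡k) (m-diagonal i) = reflect-reflect i β
  ... | no i≢j with s≤s (s≤s {n = k} _) ← 2≤m i≢j mᵢⱼ≡k = λ l → *-cancelˡ D≉0 (begin
    D * act a β l
      ≈⟨ solve 2 (λ d b → d :* b := d :* b :+ 𝟘 :* b) ≈-refl D (act a β l) ⟩
    D * act a β l + 0# * act a β l              ≈⟨ act-lincomb a D β 0# β l ⟨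
    act a (lincomb D β 0# β) l                  ≈⟨ act-cong a Dβ≋β′+γ l ⟩
    act a (lincomb 1# β′ 1# γ) l                ≈⟨ act-lincomb a 1# β′ 1# γ l ⟩
    1# * act a β′ l + 1# * act a γ l
      ≈⟨ +-cong (*-congˡ (act-relator-fixes (suc (suc k)) ⊥αᵢ ⊥αⱼ l)) (*-congˡ (act-γ l)) ⟩
    1# * β′ l + 1# * γ l                        ≈⟨ Dβ≋β′+γ l ⟨
    D * β l + 0# * β l
      ≈⟨ solve 2 (λ d b → d :* b :+ 𝟘 :* b := d :* b) ≈-refl D (β l) ⟩
    D * β l                                     ∎)
    where
    a : Word
    a = relator i j (suc (suc k))
    g D x y : Carrier
    g = gram (m i j)
    D = 1# - g * g
    -- Cramer's rule for the Gram matrix of αᵢ and αⱼ, whose determinant is D = 1 - g², that is sin²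
    -- θ. With the denominator cleared, γ is D times the projection of β to the plane, and Dβ = β′ +
    -- γ with β′ orthogonal to the plane. D is cancelled at the end.
    x = pairing β i - g * pairing β j
    y = pairing β j - g * pairing β i
    γ β′ : V
    γ  = lincomb x (α i) y (α j)
    β′ = lincomb D β (- 1#) γ

    g≈-cosθ : g ≈ - cos (θ k)
    g≈-cosθ = ≈-reflexive (≡.cong gram mᵢⱼ≡k)

    D≉0 : ¬ D ≈ 0#
    D≉0 D≈0 = sin≉0⇒1-gram²≉0 (sinθ≉0 k) (≈-trans (+-congˡ (-‿cong (*-cong (≈-sym g≈-cosθ) (≈-sym g≈-cosθ)))) D≈0)

    pairing-γ : ∀ r → pairing γ r ≈ x * gram (m i r) + y * gram (m j r)
    pairing-γ r = ≈-trans (pairing-lincomb x (α i) y (α j) r)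
      (+-cong (*-congˡ (pairing-α i r)) (*-congˡ (pairing-α j r)))

    ⊥αᵢ : pairing β′ i ≈ 0#
    ⊥αᵢ = begin
      pairing β′ i           ≈⟨ pairing-lincomb D β (- 1#) γ i ⟩
      D * pairing β i + - 1# * pairing γ i
        ≈⟨ +-congˡ (*-congˡ (≈-trans (pairing-γ i)
             (+-cong (*-congˡ (gram-diagonal i)) (*-congˡ (≈-reflexive (≡.cong gram (m-sym j i))))))) ⟩
      D * pairing β i + - 1# * (x * 1# + y * g)
        ≈⟨ solve 3 (λ g p q → (𝟙 :- g :* g) :* p :+ :- 𝟙 :* ((p :- g :* q) :* 𝟙 :+ (q :- g :* p) :* g) := 𝟘)
             ≈-refl g (pairing β i) (pairing β j) ⟩
      0#                                                    ∎

    ⊥αⱼ : pairing β′ j ≈ 0#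
    ⊥αⱼ = begin
      pairing β′ j           ≈⟨ pairing-lincomb D β (- 1#) γ j ⟩
      D * pairing β j + - 1# * pairing γ j
        ≈⟨ +-congˡ (*-congˡ (≈-trans (pairing-γ j) (+-congˡ (*-congˡ (gram-diagonal j))))) ⟩
      D * pairing β j + - 1# * (x * g + y * 1#)
        ≈⟨ solve 3 (λ g p q → (𝟙 :- g :* g) :* q :+ :- 𝟙 :* ((p :- g :* q) :* g :+ (q :- g :* p) :* 𝟙) := 𝟘)
             ≈-refl g (pairing β i) (pairing β j) ⟩
      0#                                                    ∎

    Dβ≋β′+γ : lincomb D β 0# β ≋ lincomb 1# β′ 1# γ
    Dβ≋β′+γ l = solve 3 (λ d b c → d :* b :+ 𝟘 :* b := 𝟙 :* (d :* b :+ :- 𝟙 :* c) :+ 𝟙 :* c) ≈-refl D (β l) (γ l)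

    n : ℕ
    n = suc (suc k)

    U₂ₙ≈0 : chebyshev g (n ℕ.+ n) ≈ 0#
    U₂ₙ≈0 rewrite mᵢⱼ≡k = chebyshev-2m k

    U₁₊₂ₙ≈1 : chebyshev g (suc (n ℕ.+ n)) ≈ 1#
    U₁₊₂ₙ≈1 rewrite mᵢⱼ≡k = chebyshev-1+2m k

    act-αᵢ : act a (α i) ≋ α i
    act-αᵢ l = begin
      act a (α i) l                    ≈⟨ act-relator-αᵢ i j n l ⟩
      chebyshev g (suc (n ℕ.+ n)) * α i l + chebyshev g (n ℕ.+ n) * α j l
        ≈⟨ +-cong (*-congʳ U₁₊₂ₙ≈1) (*-congʳ U₂ₙ≈0) ⟩
      1# * α i l + 0# * α j l          ≈⟨ solve 2 (λ a b → 𝟙 :* a :+ 𝟘 :* b := a) ≈-refl (α i l) (α j l) ⟩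
      α i l                            ∎

    act-αⱼ : act a (α j) ≋ α j
    act-αⱼ l = begin
      act a (α j) l                    ≈⟨ act-relator-αⱼ i j n l ⟩
      - chebyshev g (n ℕ.+ n) * α i l + (chebyshev g (suc (n ℕ.+ n)) + (1# + 1#) * g * chebyshev g (n ℕ.+ n)) * α j l
        ≈⟨ +-cong (*-congʳ (-‿cong U₂ₙ≈0)) (*-congʳ (+-cong U₁₊₂ₙ≈1 (*-congˡ U₂ₙ≈0))) ⟩
      - 0# * α i l + (1# + (1# + 1#) * g * 0#) * α j l
        ≈⟨ solve 3 (λ a b g → :- 𝟘 :* a :+ (𝟙 :+ 𝟚 :* g :* 𝟘) :* b := b) ≈-refl (α i l) (α j l) g ⟩
      α j l                            ∎

    act-γ : act a γ ≋ γ
    act-γ = ≋-trans (act-lincomb a x (α i) y (α j)) (lincomb-cong x y act-αᵢ act-αⱼ)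

  -- By `presented`, words with equal values are linked by inserting and deleting relators, and
  -- relators act trivially.
  act-wellDefined : ∀ a b β → eval a ≈ᵂ eval b → act a β ≋ act b β
  act-wellDefined a b β a≈b =
    EqClosure.gfold ≋-isEquivalence (λ a → act a β) step-preserves (W.presented a b a≈b)
    where
    ≋-isEquivalence : IsEquivalence _≋_
    ≋-isEquivalence = record { refl = ≋-refl ; sym = ≋-sym ; trans = ≋-trans }

    step-preserves : ∀ {a b} → Step W.markedGroup a b → act a β ≋ act b β
    step-preserves (step u v {i} {j} {k} mᵢⱼ≡k) = ≋-trans
      (≋-reflexive (≡.trans (act-++ u _ β) (≡.cong (act u) (act-++ (relator i j k) v β))))
      (≋-trans (act-cong u (act-relator (act v β) mᵢⱼ≡k)) (≋-reflexive (≡.sym (act-++ u v β))))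

  infix 4 _≤∞_

  data _≤∞_ (k : ℕ) : ℕ∞ → Set where
    ≤-fin : ∀ {n} → k ℕ.≤ n → k ≤∞ fin n
    ≤-∞  : k ≤∞ ∞

  -- These are the coefficients of roots in a dihedral subgroup. An alternating word of k letters
  -- involves the indices k and k + 1, so it can be treated as long as k + 1 does not exceed m.
  chebyshev-gram-nonNeg : ∀ {p q k} → p ≢ q → k ≤∞ m p q → 0# ≤ chebyshev (gram (m p q)) k
  chebyshev-gram-nonNeg {p} {q} {k} p≢q k≤m with m p q in mₚ≡
  chebyshev-gram-nonNeg {k = k} p≢q ≤-∞ | ∞ = ≤-respʳ-≈ (≈-sym (chebyshev[-1]≈k k)) (·-nonNeg k 0≤1)
  chebyshev-gram-nonNeg p≢q (≤-fin k≤n) | fin n with s≤s (s≤s {n = n} _) ← 2≤m p≢q mₚ≡ = chebyshev-nonNeg n k≤n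

-- Every root is nonnegative or nonpositive

module Positivity (em : ExcludedMiddle 0ℓ) (ℝ : RealField) (W : CoxeterSystem) where
  open Real ℝ
  open Trigonometry em ℝ
  open CoxeterGeometry em ℝ W
  open Geometry em ℝ W.markedGroup
  open W using (I; Word; m; m-order; s; eval; involutive)
  open MarkedGroup W.markedGroup using () renaming (_∙_ to infixl 7 _∙_; _≈_ to infix 4 _≈ᵂ_)
  module R = SetoidReasoning G.setoid

  length-alternating : ∀ p q k → length (alternating p q k) ≡ k
  length-alternating p q zero    = ≡.refl
  length-alternating p q (suc k) = ≡.cong suc (length-alternating q p k)

  eval-∷ʳ : ∀ a i → eval (a ∷ʳ i) ≈ᵂ eval a ∙ s i
  eval-∷ʳ a i = G.trans (eval-++ a [ i ]) (G.∙-congˡ (G.identityʳ (s i)))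

  ss-cancelˡ : ∀ i x → s i ∙ (s i ∙ x) ≈ᵂ x
  ss-cancelˡ i x = G.trans (G.sym (G.assoc _ _ _)) (G.trans (G.∙-congʳ (involutive i)) (G.identityˡ x))

  ss-cancelʳ : ∀ x i → x ∙ s i ∙ s i ≈ᵂ x
  ss-cancelʳ x i = G.trans (G.assoc _ _ _) (G.trans (G.∙-congˡ (involutive i)) (G.identityʳ x))

  -- Valid for all k; when k is the order of sₚs_q the power disappears and the braid relation
  -- remains.
  pow∙alternating : ∀ p q k → pow W.group k (s p ∙ s q) ∙ eval (alternating q p k) ≈ᵂ eval (alternating p q k)
  pow∙alternating p q zero    = G.identityˡ _
  pow∙alternating p q (suc k) = R.begin
    (s p ∙ s q ∙ pow W.group k (s p ∙ s q)) ∙ (s q ∙ X)      R.≈⟨ G.assoc _ _ _ ⟨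
    (s p ∙ s q ∙ pow W.group k (s p ∙ s q)) ∙ s q ∙ X        R.≈⟨ G.∙-congʳ (G.∙-congʳ (G.assoc _ _ _)) ⟩
    s p ∙ (s q ∙ pow W.group k (s p ∙ s q)) ∙ s q ∙ X
      R.≈⟨ G.∙-congʳ (G.∙-congʳ (G.∙-congˡ (pow-∙-swap k (s p) (s q)))) ⟨
    s p ∙ (pow W.group k (s q ∙ s p) ∙ s q) ∙ s q ∙ X
      R.≈⟨ G.∙-congʳ (G.trans (G.assoc _ _ _) (G.∙-congˡ (ss-cancelʳ _ q))) ⟩
    s p ∙ pow W.group k (s q ∙ s p) ∙ X                      R.≈⟨ G.assoc _ _ _ ⟩
    s p ∙ (pow W.group k (s q ∙ s p) ∙ X)                    R.≈⟨ G.∙-congˡ (pow∙alternating q p k) ⟩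
    s p ∙ eval (alternating q p k)                           R.∎
    where
    X : W.Carrier
    X = eval (alternating p q k)

  braid : ∀ {p q k} → m p q ≡ fin k → eval (alternating q p k) ≈ᵂ eval (alternating p q k)
  braid {p} {q} {k} mₚ≡k with _ , pqᵏ≈ε , _ ← ≡.subst (HasOrder W.group (s p ∙ s q)) mₚ≡k (m-order p q) =
    G.trans (G.sym (G.trans (G.∙-congʳ pqᵏ≈ε) (G.identityˡ _))) (pow∙alternating p q k)

  infix 4 _≤ℓ_

  -- The proof uses lower bounds on the Coxeter length alone, so the length function itself is never
  -- introduced.
  _≤ℓ_ : ℕ → W.Carrier → Set
  n ≤ℓ w = ∀ b → eval b ≈ᵂ w → n ℕ.≤ length b

  suc-≤∞ : ∀ {k n} → k ≤∞ n → n ≢ fin k → suc k ≤∞ n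
  suc-≤∞ (≤-fin k≤n) n≢k = ≤-fin (ℕ.≤∧≢⇒< k≤n (n≢k ∘ ≡.cong fin ∘ ≡.sym))
  suc-≤∞ ≤-∞         _   = ≤-∞

  lincomb-nonNeg : ∀ {x β y γ} → 0# ≤ x → NonNeg β → 0# ≤ y → NonNeg γ → NonNeg (lincomb x β y γ)
  lincomb-nonNeg 0≤x 0≤β 0≤y 0≤γ l = +-nonNeg (*-nonNeg 0≤x (0≤β l)) (*-nonNeg 0≤y (0≤γ l))

  -- A minimal word for w is written as v followed by an alternating word in p
  -- and q, and letters are moved from v to the alternating word until neither
  -- p nor q shortens v.
  module Descent (N : ℕ)
    (descend : ∀ {n} → n ℕ.< N → ∀ a i → length a ℕ.≤ n → n ≤ℓ eval a → n ≤ℓ eval a ∙ s i → NonNeg (act a (α i)))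
    (a : Word) (r : I) (N≤ℓw : N ≤ℓ eval a) (N≤ℓws : N ≤ℓ eval a ∙ s r) where

    module _ (v : Word) {p q k} (continues : alternating p q (suc (suc k)) ≡ alternating p q (suc k) ∷ʳ r)
             (factorises : eval v ∙ eval (alternating p q (suc k)) ≈ᵂ eval a)
             (len : length v ℕ.+ suc k ℕ.≤ N) where

      -- Otherwise appending r gives an alternating word of m + 1 letters. A braid move on its last
      -- m letters makes its first two letters equal; they cancel, and w sᵣ has fewer than N
      -- letters.
      k≢m : m p q ≢ fin (suc k)
      k≢m mₚ≡k = ℕ.<⇒≱ (ℕ.≤-trans (ℕ.≤-reflexive (≡.sym (ℕ.+-suc (length v) k))) len)
        (≡.subst (N ℕ.≤_) (≡.trans (length-++ v) (≡.cong (length v ℕ.+_) (length-alternating q p k)))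
          (N≤ℓws (v ++ alternating q p k) (G.sym (R.begin
            eval a ∙ s r                                              R.≈⟨ G.∙-congʳ factorises ⟨
            eval v ∙ eval (alternating p q (suc k)) ∙ s r             R.≈⟨ G.assoc _ _ _ ⟩
            eval v ∙ (eval (alternating p q (suc k)) ∙ s r)
              R.≈⟨ G.∙-congˡ (eval-∷ʳ (alternating p q (suc k)) r) ⟨
            eval v ∙ eval (alternating p q (suc k) ∷ʳ r)
              R.≡⟨ ≡.cong (λ b → eval v ∙ eval b) continues ⟨
            eval v ∙ (s p ∙ eval (alternating q p (suc k)))
              R.≈⟨ G.∙-congˡ (G.∙-congˡ (braid mₚ≡k)) ⟩
            eval v ∙ (s p ∙ (s p ∙ eval (alternating q p k)))         R.≈⟨ G.∙-congˡ (ss-cancelˡ p _) ⟩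
            eval v ∙ eval (alternating q p k)                         R.≈⟨ eval-++ v _ ⟨
            eval (v ++ alternating q p k)                             R.∎))))

      length-v<N : length v ℕ.< N
      length-v<N = ℕ.≤-trans (ℕ.m<m+n (length v) (s≤s z≤n)) len

      length-v≤ℓ : length v ≤ℓ eval v
      length-v≤ℓ b b≈v = ℕ.+-cancelʳ-≤ (suc k) (length v) (length b) (ℕ.≤-trans len
        (≡.subst (N ℕ.≤_) (≡.trans (length-++ b) (≡.cong (length b ℕ.+_) (length-alternating p q (suc k))))
          (N≤ℓw (b ++ alternating p q (suc k)) (G.trans (eval-++ b _) (G.trans (G.∙-congʳ b≈v) factorises)))))

      -- The alternating word begins with p, so v sₚ followed by its remaining k letters is w. A
      -- short word for v sₚ would thus make w too short.
      length-v≤ℓp : length v ≤ℓ eval v ∙ s p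
      length-v≤ℓp b b≈vp = ℕ.≤-trans (ℕ.n≤1+n _) (ℕ.+-cancelʳ-≤ k (suc (length v)) (length b)
        (ℕ.≤-trans (ℕ.≤-reflexive (≡.sym (ℕ.+-suc (length v) k)))
        (ℕ.≤-trans len
          (≡.subst (N ℕ.≤_) (≡.trans (length-++ b) (≡.cong (length b ℕ.+_) (length-alternating q p k)))
            (N≤ℓw (b ++ alternating q p k) (R.begin
              eval (b ++ alternating q p k)                 R.≈⟨ eval-++ b _ ⟩
              eval b ∙ eval (alternating q p k)             R.≈⟨ G.∙-congʳ b≈vp ⟩
              eval v ∙ s p ∙ eval (alternating q p k)       R.≈⟨ G.assoc _ _ _ ⟩
              eval v ∙ eval (alternating p q (suc k))       R.≈⟨ factorises ⟩
              eval a                                        R.∎))))))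

    peel : ∀ v {p q} k → Acc ℕ._<_ (length v) → p ≢ q → suc k ≤∞ m p q →
           alternating p q (suc (suc k)) ≡ alternating p q (suc k) ∷ʳ r →
           eval v ∙ eval (alternating p q (suc k)) ≈ᵂ eval a →
           length v ℕ.+ suc k ℕ.≤ N → NonNeg (act a (α r))
    peel v {p} {q} k (acc rs) p≢q k≤m continues factorises len
      -- Testing q suffices, as `length-v≤ℓp` settles p. If q shortens v, it becomes the new first
      -- letter of the alternating word and p and q exchange roles.
      with em {∃[ b ] eval b ≈ᵂ eval v ∙ s q × length b ℕ.< length v}
    ... | yes (b , b≈vq , b<v) = peel b (suc k) (rs b<v) (p≢q ∘ ≡.sym)
            (≡.subst (suc (suc k) ≤∞_) (m-sym p q) (suc-≤∞ k≤m (k≢m v continues factorises len)))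
            (≡.cong (q ∷_) continues)
            (R.begin
              eval b ∙ (s q ∙ eval (alternating p q (suc k)))          R.≈⟨ G.∙-congʳ b≈vq ⟩
              eval v ∙ s q ∙ (s q ∙ eval (alternating p q (suc k)))    R.≈⟨ G.assoc _ _ _ ⟩
              eval v ∙ (s q ∙ (s q ∙ eval (alternating p q (suc k))))  R.≈⟨ G.∙-congˡ (ss-cancelˡ q _) ⟩
              eval v ∙ eval (alternating p q (suc k))                  R.≈⟨ factorises ⟩
              eval a                                                   R.∎)
            (ℕ.≤-trans (ℕ.≤-reflexive (ℕ.+-suc (length b) (suc k))) (ℕ.≤-trans (ℕ.+-monoˡ-≤ (suc k) b<v) len))
    -- By induction v keeps αₚ and α_q nonnegative, and the image of αᵣ combines the two with
    -- Chebyshev coefficients.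
    ... | no ∄b = NonNeg-resp (≋-sym act-a) (lincomb-nonNeg
            (chebyshev-gram-nonNeg p≢q (suc-≤∞ k≤m (k≢m v continues factorises len)))
            (descend (length-v<N v continues factorises len) v p ℕ.≤-refl
              (length-v≤ℓ v continues factorises len) (length-v≤ℓp v continues factorises len))
            (chebyshev-gram-nonNeg p≢q k≤m)
            (descend (length-v<N v continues factorises len) v q ℕ.≤-refl
              (length-v≤ℓ v continues factorises len) (λ b b≈vq → ℕ.≮⇒≥ (λ b<v → ∄b (b , b≈vq , b<v)))))
      where
      act-a : act a (α r) ≋ lincomb (chebyshev (gram (m p q)) (suc (suc k))) (act v (α p))
                                    (chebyshev (gram (m p q)) (suc k)) (act v (α q))
      act-a = ≋-trans (act-wellDefined a (v ++ alternating p q (suc k)) (α r)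
        (G.trans (G.sym factorises) (G.sym (eval-++ v _))))
        (≋-trans (≋-reflexive (act-++ v _ (α r)))
        (≋-trans (act-cong v (act-alternating (suc k) continues)) (act-lincomb v _ (α p) _ (α q))))

  1≤∞m : ∀ i j → 1 ≤∞ m i j
  1≤∞m i j with m i j | m-order i j
  ... | fin k | 1≤k , _ = ≤-fin 1≤k
  ... | ∞     | _       = ≤-∞

  -- The first two conditions say that a is reduced of length N. The third, that w sᵢ is not shorter
  -- than w, is the form that a negative answer of `em` to the search for a shorter word provides.
  ascent-nonNeg : ∀ {N} → Acc ℕ._<_ N → ∀ a i → length a ℕ.≤ N →
    N ≤ℓ eval a → N ≤ℓ eval a ∙ s i → NonNeg (act a (α i))
  ascent-nonNeg {N} (acc rs) a i len N≤ℓw N≤ℓws with initLast a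
  ... | [] = α-nonNeg i
  ... | v ∷ʳ′ t with t Fin.≟ i
  ...   | yes ≡.refl = contradiction (N≤ℓws v (G.sym (G.trans (G.∙-congʳ (eval-∷ʳ v t)) (ss-cancelʳ _ t))))
                         (ℕ.<⇒≱ (≡.subst (ℕ._≤ N) (≡.trans (length-++ v) (ℕ.+-comm (length v) 1)) len))
  -- The last letter t is the initial alternating word, with p = t, q = i and i as the letter that
  -- continues it.
  ...   | no t≢i = Descent.peel N (λ n<N → ascent-nonNeg (rs n<N)) (v ∷ʳ t) i N≤ℓw N≤ℓws
                     v 0 (<-wellFounded (length v)) t≢i (1≤∞m t i) ≡.refl
                     (G.sym (eval-++ v [ t ])) (ℕ.≤-trans (ℕ.≤-reflexive (≡.sym (length-++ v))) len)

  reducedWord : ∀ a → Acc ℕ._<_ (length a) → ∃[ b ] eval b ≈ᵂ eval a × length b ℕ.≤ length a × length b ≤ℓ eval b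
  reducedWord a (acc rs) with em {∃[ b ] eval b ≈ᵂ eval a × length b ℕ.< length a}
  ... | no ∄b = a , G.refl , ℕ.≤-refl , λ b b≈a → ℕ.≮⇒≥ (λ b<a → ∄b (b , b≈a , b<a))
  ... | yes (b , b≈a , b<a) with c , c≈b , c≤b , c-reduced ← reducedWord b (rs b<a) =
    c , G.trans c≈b b≈a , ℕ.≤-trans c≤b (ℕ.<⇒≤ b<a) , c-reduced

  -- If sᵢ shortens w, take a reduced word for w sᵢ: multiplying it by sᵢ gives back the longer w,
  -- so the ascent case applies to it.
  act-α-reduced : ∀ a i → length a ≤ℓ eval a → NonNeg (act a (α i)) ⊎ NonNeg (act (a ∷ʳ i) (α i))
  act-α-reduced a i a-reduced with em {∃[ b ] eval b ≈ᵂ eval a ∙ s i × length b ℕ.< length a}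
  ... | no ∄b = inj₁ (ascent-nonNeg (<-wellFounded _) a i ℕ.≤-refl a-reduced λ b b≈as → ℕ.≮⇒≥ (λ b<a → ∄b (b , b≈as , b<a)))
  ... | yes (b , b≈as , b<a) with c , c≈b , c≤b , c-reduced ← reducedWord b (<-wellFounded _) =
    inj₂ (NonNeg-resp (act-wellDefined c (a ∷ʳ i) (α i) (G.trans (G.trans c≈b b≈as) (G.sym (eval-∷ʳ a i))))
      (ascent-nonNeg (<-wellFounded _) c i ℕ.≤-refl c-reduced λ d d≈cs →
        ℕ.≤-trans (ℕ.≤-trans c≤b (ℕ.<⇒≤ b<a)) (a-reduced d (G.trans d≈cs
          (G.trans (G.∙-congʳ (G.trans c≈b b≈as)) (ss-cancelʳ _ i))))))

  reflect-α-self : ∀ i l → reflect i (α i) l ≈ - α i l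
  reflect-α-self i l = ≈-trans (reflect-α i i l) (≈-trans (+-congˡ (-‿cong (*-congʳ (*-congˡ (gram-diagonal i)))))
    (solve 1 (λ a → a :- 𝟚 :* 𝟙 :* a := :- a) ≈-refl (α i l)))

  -- The second alternative of `act-α-reduced` becomes nonpositivity because w sᵢ αᵢ = - w αᵢ.
  root-sign : ∀ a i → NonNeg (act a (α i)) ⊎ (∀ l → act a (α i) l ≤ 0#)
  root-sign a i with reducedWord a (<-wellFounded _)
  ... | b , b≈a , _ , b-reduced with act-α-reduced b i b-reduced
  ...   | inj₁ 0≤bαᵢ  = inj₁ (NonNeg-resp (act-wellDefined b a (α i) b≈a) 0≤bαᵢ)
  ...   | inj₂ 0≤bsαᵢ = inj₂ λ l → 0≤-x⇒x≤0 (≤-respʳ-≈ (act-∷ʳ l) (0≤bsαᵢ l))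
    where
    act-∷ʳ : ∀ l → act (b ∷ʳ i) (α i) l ≈ - act a (α i) l
    act-∷ʳ l = begin
      act (b ∷ʳ i) (α i) l                      ≡⟨ ≡.cong (λ β → β l) (act-++ b [ i ] (α i)) ⟩
      act b (reflect i (α i)) l
        ≈⟨ act-cong b (λ l → ≈-trans (reflect-α-self i l) (-x≈-1x+0x (α i l))) l ⟩
      act b (lincomb (- 1#) (α i) 0# (α i)) l   ≈⟨ act-lincomb b (- 1#) (α i) 0# (α i) l ⟩
      - 1# * act b (α i) l + 0# * act b (α i) l ≈⟨ -x≈-1x+0x _ ⟨
      - act b (α i) l                           ≈⟨ -‿cong (act-wellDefined b a (α i) b≈a l) ⟩
      - act a (α i) l                           ∎
      where
      -x≈-1x+0x : ∀ x → - x ≈ - 1# * x + 0# * x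
      -x≈-1x+0x = solve 1 (λ x → :- x := :- 𝟙 :* x :+ 𝟘 :* x) ≈-refl

lookup-injective : ∀ {A : Set} {xs : List A} → Unique xs → ∀ {i j} → lookup xs i ≡ lookup xs j → i ≡ j
lookup-injective (_ ∷ _)     {zero}  {zero}  _  = ≡.refl
lookup-injective (x∉xs ∷ _)  {zero}  {suc j} eq = contradiction eq (All.lookup x∉xs (∈-lookup j))
lookup-injective (x∉xs ∷ _)  {suc i} {zero}  eq = contradiction (≡.sym eq) (All.lookup x∉xs (∈-lookup i))
lookup-injective (_ ∷ xs!)   {suc i} {suc j} eq = ≡.cong suc (lookup-injective xs! eq)

filter-++-∁ : ∀ {A : Set} {P : Pred A 0ℓ} (P? : Decidable P) xs → filter P? xs ++ filter (∁? P?) xs ↭ xs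
filter-++-∁ P? []       = ↭-refl
filter-++-∁ P? (x ∷ xs) with P? x
... | yes _ = prep x (filter-++-∁ P? xs)
... | no  _ = ↭-trans (shift x (filter P? xs) _) (prep x (filter-++-∁ P? xs))

-- The root space of W_J inside that of W

module ParabolicSubgroup (em : ExcludedMiddle 0ℓ) (ℝ : RealField) (W : CoxeterSystem)
    (J : Subset (CoxeterSystem.rank W)) where
  open Real ℝ
  open SemiringSum semiring using (sum; sum-cong-≋; ∑-distrib-+; ∑-comm; *-distribˡ-sum; *-distribʳ-sum)
  open CoxeterGeometry em ℝ W using (module W; module G; act-wellDefined)
  open Positivity em ℝ W using (eval-∷ʳ; root-sign)
  open Geometry em ℝ W.markedGroup
  open Parabolic W J using (elementsJ; ι; ⟨s_J⟩; gen; unit; mul; inverse; resp)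
  open W using (I; rank; m; s; eval; inv)
  open MarkedGroup W.markedGroup using () renaming (_∙_ to infixl 7 _∙_; _≈_ to infix 4 _≈ᵂ_)
  module W′ = MarkedGroup (parabolic W J)
  module T′ = Geometry em ℝ (parabolic W J)

  ι-injective : ∀ {j k} → ι j ≡ ι k → j ≡ k
  ι-injective = lookup-injective (filter⁺ (_∈? J) (allFin⁺ rank))

  ι∈J : ∀ j → ι j ∈ˢ J
  ι∈J j = All.lookup (all-filter (_∈? J) (allFin rank)) (∈-lookup j)

  -- The inclusion of the coordinates in J, padded by zeros. As a combination of simple roots it is
  -- visibly linear, and its pairings reduce to entries of the Gram matrix.
  extend : T′.V → V
  extend β l = sum λ j → β j * α (ι j) l

  extend-cong : ∀ {β γ} → β T′.≋ γ → extend β ≋ extend γ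
  extend-cong β≋γ l = sum-cong-≋ λ j → *-congʳ (β≋γ j)

  extend-lincomb : ∀ x β y γ → extend (T′.lincomb x β y γ) ≋ lincomb x (extend β) y (extend γ)
  extend-lincomb x β y γ l = begin
    sum (λ j → (x * β j + y * γ j) * α (ι j) l)
      ≈⟨ sum-cong-≋ (λ j → solve 5 (λ x b y c a → (x :* b :+ y :* c) :* a := x :* (b :* a) :+ y :* (c :* a))
                                   ≈-refl x (β j) y (γ j) (α (ι j) l)) ⟩
    sum (λ j → x * (β j * α (ι j) l) + y * (γ j * α (ι j) l))
      ≈⟨ ∑-distrib-+ (λ j → x * (β j * α (ι j) l)) (λ j → y * (γ j * α (ι j) l)) ⟩
    sum (λ j → x * (β j * α (ι j) l)) + sum (λ j → y * (γ j * α (ι j) l))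
      ≈⟨ +-cong (*-distribˡ-sum x λ j → β j * α (ι j) l) (*-distribˡ-sum y λ j → γ j * α (ι j) l) ⟨
    x * extend β l + y * extend γ l   ∎

  extend-α : ∀ j → extend (T′.α j) ≋ α (ι j)
  extend-α j l = T′.sum-α j λ k → α (ι k) l

  extend-ι : ∀ β j → extend β (ι j) ≈ β j
  extend-ι β j = begin
    sum (λ k → β k * α (ι k) (ι j))
      ≈⟨ sum-cong-≋ (λ k → ≈-trans (*-comm _ _) (*-congʳ (≈-reflexive (α-ι k)))) ⟩
    sum (λ k → T′.α j k * β k)          ≈⟨ T′.sum-α j β ⟩
    β j                                 ∎
    where
    α-ι : ∀ k → α (ι k) (ι j) ≡ T′.α j k
    α-ι k = ≡.cong (if_then 1# else 0#)
      (does-⇔ (mk⇔ (≡.sym ∘ ι-injective) (≡.cong ι ∘ ≡.sym)) (ι k Fin.≟ ι j) (j Fin.≟ k))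

  -- The two instances of `gram` belong to different marked groups and compute to the same value
  -- only after a case split.
  gram-parabolic : ∀ n → gram n ≡ T′.gram n
  gram-parabolic (fin k) = ≡.refl
  gram-parabolic ∞       = ≡.refl

  pairing-extend : ∀ β j → pairing (extend β) (ι j) ≈ T′.pairing β j
  pairing-extend β j = begin
    sum (λ l → sum (λ k → β k * α (ι k) l) * g l)
      ≈⟨ sum-cong-≋ (λ l → *-distribʳ-sum (g l) λ k → β k * α (ι k) l) ⟩
    sum (λ l → sum (λ k → β k * α (ι k) l * g l))     ≈⟨ ∑-comm (λ l k → β k * α (ι k) l * g l) ⟩
    sum (λ k → sum (λ l → β k * α (ι k) l * g l))
      ≈⟨ sum-cong-≋ (λ k → ≈-trans
           (sum-cong-≋ λ l → solve 3 (λ b a g → b :* a :* g := a :* (b :* g)) ≈-refl (β k) (α (ι k) l) (g l))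
           (sum-α (ι k) λ l → β k * g l)) ⟩
    sum (λ k → β k * g (ι k))
      ≈⟨ sum-cong-≋ (λ k → *-congˡ (≈-reflexive (gram-parabolic (m (ι k) (ι j))))) ⟩
    T′.pairing β j                                    ∎
    where
    g : I → Carrier
    g l = gram (m l (ι j))

  reflect-extend : ∀ j β → reflect (ι j) (extend β) ≋ extend (T′.reflect j β)
  reflect-extend j β l = begin
    reflect (ι j) (extend β) l
      ≈⟨ reflect≈ (ι j) (extend β) l ⟩
    extend β l - (1# + 1#) * pairing (extend β) (ι j) * α (ι j) l
      ≈⟨ +-congˡ (-‿cong (*-cong (*-congˡ (pairing-extend β j)) (≈-sym (extend-α j l)))) ⟩
    extend β l - 2p * extend (T′.α j) l
      ≈⟨ solve 3 (λ b p a → b :- p :* a := 𝟙 :* b :+ :- p :* a) ≈-refl (extend β l) 2p (extend (T′.α j) l) ⟩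
    1# * extend β l + - 2p * extend (T′.α j) l
      ≈⟨ extend-lincomb 1# β (- 2p) (T′.α j) l ⟨
    extend (T′.lincomb 1# β (- 2p) (T′.α j)) l
      ≈⟨ extend-cong (λ k → ≈-trans (solve 3 (λ b p a → 𝟙 :* b :+ :- p :* a := b :- p :* a) ≈-refl (β k) 2p (T′.α j k))
                                    (≈-sym (T′.reflect≈ j β k))) l ⟩
    extend (T′.reflect j β) l   ∎
    where
    2p : Carrier
    2p = (1# + 1#) * T′.pairing β j

  act-extend : ∀ a β → act (map ι a) (extend β) ≋ extend (T′.act a β)
  act-extend []      β = ≋-refl
  act-extend (j ∷ a) β = ≋-trans (reflect-cong (ι j) (act-extend a β)) (reflect-extend j (T′.act a β))

  act-ι-α : ∀ a j → act (map ι a) (α (ι j)) ≋ extend (T′.act a (T′.α j))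
  act-ι-α a j = ≋-trans (act-cong (map ι a) (≋-sym (extend-α j))) (act-extend a (T′.α j))

  sum-nonNeg : ∀ {n} (f : Fin n → Carrier) → (∀ i → 0# ≤ f i) → 0# ≤ sum f
  sum-nonNeg {zero}  f 0≤f = ≤-refl
  sum-nonNeg {suc n} f 0≤f = +-nonNeg (0≤f zero) (sum-nonNeg (f ∘ suc) (0≤f ∘ suc))

  extend-nonNeg : ∀ {β} → T′.NonNeg β → NonNeg (extend β)
  extend-nonNeg 0≤β l = sum-nonNeg _ λ j → *-nonNeg (0≤β j) (α-nonNeg (ι j) l)

  extend-nonNeg⁻¹ : ∀ {β} → NonNeg (extend β) → T′.NonNeg β
  extend-nonNeg⁻¹ {β} 0≤β j = ≤-respʳ-≈ (extend-ι β j) (0≤β (ι j))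

  eval-ι : ∀ a → proj₁ (W′.eval a) ≡ eval (map ι a)
  eval-ι []      = ≡.refl
  eval-ι (j ∷ a) = ≡.cong (s (ι j) ∙_) (eval-ι a)

  inverseWord : ∀ a → ∃[ b ] eval (map ι b) ≈ᵂ inv (eval (map ι a))
  inverseWord []      = [] , G.sym ε⁻¹≈ε
    where open GroupProperties W.group using (ε⁻¹≈ε)
  inverseWord (j ∷ a) with b , b≈a⁻¹ ← inverseWord a = b ∷ʳ j , (R.begin
    eval (map ι (b ∷ʳ j))                     R.≡⟨ ≡.cong eval (map-++ ι b [ j ]) ⟩
    eval (map ι b ∷ʳ ι j)                     R.≈⟨ eval-∷ʳ (map ι b) (ι j) ⟩
    eval (map ι b) ∙ s (ι j)                  R.≈⟨ G.∙-cong b≈a⁻¹ (inverseʳ-unique _ _ (W.involutive (ι j))) ⟩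
    inv (eval (map ι a)) ∙ inv (s (ι j))      R.≈⟨ ⁻¹-anti-homo-∙ _ _ ⟨
    inv (s (ι j) ∙ eval (map ι a))            R.∎)
    where
    open GroupProperties W.group using (⁻¹-anti-homo-∙; inverseʳ-unique)
    module R = SetoidReasoning G.setoid

  -- Inverses bring in no new letters, since the generators are involutions.
  wordJ : ∀ {w} → ⟨s_J⟩ w → ∃[ a ] eval (map ι a) ≈ᵂ w
  wordJ (gen j)       = [ j ] , G.identityʳ _
  wordJ unit          = [] , G.refl
  wordJ (mul p q)     with a , a≈u ← wordJ p | b , b≈v ← wordJ q =
    a ++ b , G.trans (G.reflexive (≡.cong eval (map-++ ι a b)))
    (G.trans (eval-++ (map ι a) (map ι b)) (G.∙-cong a≈u b≈v))
  wordJ (inverse p)   with a , a≈u ← wordJ p with b , b≈a⁻¹ ← inverseWord a = b , G.trans b≈a⁻¹ (G.⁻¹-cong a≈u)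
  wordJ (resp u≈v p)  with a , a≈u ← wordJ p = a , G.trans a≈u u≈v

  Outside : I → Set
  Outside i = ∀ j → ι j ≢ i

  -- A reflection of W_J adds a multiple of a simple root of J, whose coordinate at i is zero.
  act-outside : ∀ {i} → Outside i → ∀ a β → act (map ι a) β i ≈ β i
  act-outside         i∉J []      β = ≈-refl
  act-outside {i} i∉J (j ∷ a) β = begin
    reflect (ι j) γ i                                   ≈⟨ reflect≈ (ι j) γ i ⟩
    γ i - (1# + 1#) * pairing γ (ι j) * α (ι j) i       ≈⟨ +-congˡ (-‿cong (*-congˡ αᵢ≈0)) ⟩
    γ i - (1# + 1#) * pairing γ (ι j) * 0#
      ≈⟨ solve 2 (λ c p → c :- p :* 𝟘 := c) ≈-refl (γ i) ((1# + 1#) * pairing γ (ι j)) ⟩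
    γ i                  ≈⟨ act-outside i∉J a β ⟩
    β i                                                 ∎
    where
    γ : V
    γ = act (map ι a) β
    αᵢ≈0 : α (ι j) i ≈ 0#
    αᵢ≈0 with ι j Fin.≟ i
    ... | yes ιj≡i = contradiction ιj≡i (i∉J j)
    ... | no  _    = ≈-refl

  -- The αᵢ-coordinate of u αᵢ is 1, so the root u αᵢ cannot be negative.
  act-α-outside-nonNeg : ∀ {i} → Outside i → ∀ a → NonNeg (act (map ι a) (α i))
  act-α-outside-nonNeg {i} i∉J a with root-sign (map ι a) i
  ... | inj₁ 0≤aαᵢ = 0≤aαᵢ
  ... | inj₂ aαᵢ≤0 = contradiction (≤-respˡ-≈ (≈-trans (act-outside i∉J a (α i)) αᵢᵢ≈1) (aαᵢ≤0 i)) 1≰0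
    where
    αᵢᵢ≈1 : α i i ≈ 1#
    αᵢᵢ≈1 with i Fin.≟ i
    ... | yes _   = ≈-refl
    ... | no  i≢i = contradiction ≡.refl i≢i

  -- Membership in the half-space comes with a word of its own; well-definedness of the action
  -- carries its sign over to any chosen word.
  H⁺⇒nonNeg : ∀ {a w β} → eval a ≈ᵂ w → H⁺ β w → NonNeg (act a β)
  H⁺⇒nonNeg {a} {β = β} a≈w (γ , (b , b≈w , bβ≋γ) , _ , 0≤γ) =
    NonNeg-resp (≋-sym (≋-trans (act-wellDefined a b β (G.trans a≈w (G.sym b≈w))) bβ≋γ)) 0≤γ

  Φ-extend : ∀ {β} → T′.Φ β → Φ (extend β)
  Φ-extend (_ , j , a , _ , aαⱼ≋β) =
    eval (map ι a) , ι j , map ι a , G.refl , ≋-trans (act-ι-α a j) (extend-cong aαⱼ≋β)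

  H⁺-restrict : ∀ {β γ w} → T′.Φ β → extend β ≋ γ → H⁺ γ (proj₁ w) → T′.H⁺ β w
  H⁺-restrict {β} {γ} {w , w∈W_J} Φβ β≋γ γ∈H⁺ with a , a≈w ← wordJ w∈W_J =
    T′.H⁺-intro {a} {w , w∈W_J} (G.trans (G.reflexive (eval-ι a)) a≈w) Φβ (extend-nonNeg⁻¹
      (NonNeg-resp (≋-trans (act-cong (map ι a) (≋-sym β≋γ)) (act-extend a β)) (H⁺⇒nonNeg {map ι a} {β = γ} a≈w γ∈H⁺)))

  H⁺-extend : ∀ {β γ w} → T′.Φ β → extend β ≋ γ → T′.H⁺ β w → H⁺ γ (proj₁ w)
  H⁺-extend {β} {γ} Φβ β≋γ (δ , (a , a≈w , aβ≋δ) , _ , 0≤δ) =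
    H⁺-intro {map ι a} (G.trans (G.reflexive (≡.sym (eval-ι a))) a≈w) (Φ-resp β≋γ (Φ-extend Φβ))
      (NonNeg-resp (≋-trans (extend-cong (T′.≋-sym aβ≋δ)) (≋-trans (≋-sym (act-extend a β)) (act-cong (map ι a) β≋γ)))
        (extend-nonNeg 0≤δ))

  -- The convex set in W attached to one in W_J

  module _ (L′ : Pred W′.Carrier 0ℓ) where

    data DefiningRoot (γ : V) : Set where
      inner : ∀ β → T′.R L′ β → extend β ≋ γ → DefiningRoot γ
      outer : ∀ {i} a → Outside i → act (map ι a) (α i) ≋ γ → DefiningRoot γ

    L : Pred W.Carrier 0ℓ
    L w = ∀ γ → DefiningRoot γ → H⁺ γ w

    DefiningRoot⊆Φ : DefiningRoot ⊆ Φ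
    DefiningRoot⊆Φ (inner β (Φβ , _) β≋γ)     = Φ-resp β≋γ (Φ-extend Φβ)
    DefiningRoot⊆Φ (outer {i} a i∉J aαᵢ≋γ)    = eval (map ι a) , i , map ι a , G.refl , aαᵢ≋γ

    L-convex : Convex L
    L-convex = DefiningRoot , DefiningRoot⊆Φ , λ w → mk⇔ (λ w∈L γ → w∈L γ) (λ w∈L γ → w∈L γ)

    L′⊆L : ∀ {w} → L′ w → L (proj₁ w)
    L′⊆L {w} w∈L′ γ (inner β (Φβ , L′⊆H⁺) β≋γ) = H⁺-extend {w = w} Φβ β≋γ (L′⊆H⁺ w∈L′)
    -- The product of w and the word a is again a word in the letters of J, so it also keeps αᵢ
    -- nonnegative.
    L′⊆L {w , w∈W_J} w∈L′ γ γ-root@(outer {i} a i∉J aαᵢ≋γ) with b , b≈w ← wordJ w∈W_J =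
      H⁺-intro {map ι b} b≈w (DefiningRoot⊆Φ γ-root)
        (NonNeg-resp (≋-trans (≋-reflexive (≡.trans (≡.cong (λ c → act c (α i)) (map-++ ι b a))
          (act-++ (map ι b) (map ι a) (α i))))
                              (act-cong (map ι b) aαᵢ≋γ))
          (act-α-outside-nonNeg i∉J (b ++ a)))

    -- The roots of a family that defines L′ lie in `R L′`, so their extensions are among the
    -- conditions on `L`.
    L∩W_J⊆L′ : T′.Convex L′ → ∀ {w} → L (proj₁ w) → L′ w
    L∩W_J⊆L′ (P , P⊆Φ , L′⇔P) {w} w∈L = Equivalence.from (L′⇔P w) λ β Pβ →
      H⁺-restrict {w = w} (P⊆Φ Pβ) ≋-refl
        (w∈L (extend β) (inner β (P⊆Φ Pβ , λ {v} v∈L′ → Equivalence.to (L′⇔P v) v∈L′ β Pβ) ≋-refl))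

    τ-inside : ∀ j u → τ L (ι j) (proj₁ u) ≡ proj₁ (T′.τ L′ j u)
    τ-inside j u@(u₁ , u∈W_J)
      with em {∃[ β ] (inv u₁ · α (ι j) ↦ β) × R L β} | em {∃[ β ] (W′.inv u T′.· T′.α j ↦ β) × T′.R L′ β}
    ... | yes _  | yes _  = ≡.refl
    ... | no _   | no _   = ≡.refl
    ... | no ∄γ  | yes (β , (a , a≈u⁻¹ , aαⱼ≋β) , β∈R@(Φβ , _)) = contradiction
      ( extend β
      , (map ι a , G.trans (G.reflexive (≡.sym (eval-ι a))) a≈u⁻¹ , ≋-trans (act-ι-α a j) (extend-cong aαⱼ≋β))
      , Φ-extend Φβ , λ {_} w∈L → w∈L (extend β) (inner β β∈R ≋-refl)) ∄γ
    -- The word a for u⁻¹ may use letters outside J. A word b in the letters of J gives the same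
    -- vector and shows it to be the extension of a root of W_J.
    ... | yes (γ , (a , a≈u⁻¹ , aαⱼ≋γ) , _ , L⊆H⁺) | no ∄β with b , b≈u⁻¹ ← wordJ (inverse u∈W_J) = contradiction
      ( β
      , (b , b≈′u⁻¹ , T′.≋-refl)
      , Φβ , λ {w} w∈L′ → H⁺-restrict {w = w} Φβ β≋γ (L⊆H⁺ (L′⊆L w∈L′))) ∄β
      where
      β : T′.V
      β = T′.act b (T′.α j)
      b≈′u⁻¹ : W′.eval b W′.≈ W′.inv u
      b≈′u⁻¹ = G.trans (G.reflexive (eval-ι b)) b≈u⁻¹
      Φβ : T′.Φ β
      Φβ = W′.eval b , j , b , G.refl , T′.≋-refl
      β≋γ : extend β ≋ γ
      β≋γ = ≋-trans (≋-sym (act-ι-α b j))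
        (≋-trans (act-wellDefined (map ι b) a (α (ι j)) (G.trans b≈u⁻¹ (G.sym a≈u⁻¹))) aαⱼ≋γ)

    τ-outside : ∀ {i} → Outside i → ∀ (u : W′.Carrier) → τ L i (proj₁ u) ≡ proj₁ u
    τ-outside {i} i∉J (u , u∈W_J) with em {∃[ β ] (inv u · α i ↦ β) × R L β}
    ... | yes _ = ≡.refl
    ... | no ∄β with a , a≈u⁻¹ ← wordJ (inverse u∈W_J) = contradiction
      ( act (map ι a) (α i)
      , (map ι a , a≈u⁻¹ , ≋-refl)
      , DefiningRoot⊆Φ root , λ {_} w∈L → w∈L _ root) ∄β
      where
      root : DefiningRoot (act (map ι a) (α i))
      root = outer a i∉J ≋-refl

    -- Toggles branch on `em` at a proposition about u. With propositional equality in place of `≈`,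
    -- each step can be rewritten inside the next toggle.
    toggles-restrict : ∀ o o′ → map ι o′ ≡ filter (_∈? J) o → ∀ u →
      foldl (λ v i → τ L i v) (proj₁ u) o ≡ proj₁ (foldl (λ v j → T′.τ L′ j v) u o′)
    toggles-restrict []      []       eq u = ≡.refl
    toggles-restrict (i ∷ o) o′ eq u with i ∈? J
    toggles-restrict (i ∷ o) o′       eq u | no i∉J
      rewrite τ-outside (λ j ιj≡i → i∉J (≡.subst (_∈ˢ J) ιj≡i (ι∈J j))) u = toggles-restrict o o′ eq u
    toggles-restrict (i ∷ o) (j ∷ o′) eq u | yes _ with ≡.refl , eq′ ← ∷-injective eq
      rewrite τ-inside j u = toggles-restrict o o′ eq′ (T′.τ L′ j u)

  iterate-restrict : ∀ {f : W.Carrier → W.Carrier} {f′ : W′.Carrier → W′.Carrier} →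
    (∀ u → f (proj₁ u) ≡ proj₁ (f′ u)) → ∀ u k → iterate f (proj₁ u) k ≡ proj₁ (iterate f′ u k)
  iterate-restrict f≡f′ u zero    = ≡.refl
  iterate-restrict {f} {f′} f≡f′ u (suc k) = ≡.trans (≡.cong (λ v → iterate f v k) (f≡f′ u))
    (iterate-restrict f≡f′ (f′ u) k)

  futuristicElement-restrict : ∀ {c c′} (o : IsCoxeterElement c) (o′ : T′.IsCoxeterElement c′) →
    map ι (T′.IsCoxeterElement.ordering o′) ≡ filter (_∈? J) (IsCoxeterElement.ordering o) →
    FuturisticElement o → T′.FuturisticElement o′
  futuristicElement-restrict o o′ o′≡o futuristic L′ (w , w∈L′) L′-convex {u} (k , 1≤k , uᵏ≈u) =
    L∩W_J⊆L′ L′ L′-convex (futuristic (L L′) (proj₁ w , L′⊆L L′ w∈L′) (L-convex L′)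
      (k , 1≤k , G.trans (G.reflexive (iterate-restrict
        (toggles-restrict L′ (IsCoxeterElement.ordering o) (T′.IsCoxeterElement.ordering o′) o′≡o) u k)) uᵏ≈u))

  -- Orderings of I and of J

  map-ι-allFin : map ι (allFin (length elementsJ)) ≡ filter (_∈? J) (allFin rank)
  map-ι-allFin = ≡.trans (map-tabulate (λ j → j) ι) (tabulate-lookup elementsJ)

  -- The letters outside J may stand anywhere, because their toggles fix W_J; here they come last.
  extendOrdering : List (Fin W′.rank) → List I
  extendOrdering o′ = map ι o′ ++ filter (∁? (_∈? J)) (allFin rank)

  extendOrdering-↭ : ∀ {o′} → o′ ↭ allFin W′.rank → extendOrdering o′ ↭ allFin rank
  extendOrdering-↭ {o′} o′↭ = ↭-trans
    (++⁺ʳ _ (↭-trans (map⁺ ι o′↭) (↭-reflexive map-ι-allFin)))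
    (filter-++-∁ (_∈? J) (allFin rank))

  filter-extendOrdering : ∀ o′ → map ι o′ ≡ filter (_∈? J) (extendOrdering o′)
  filter-extendOrdering o′ = ≡.sym (≡.trans (filter-++ (_∈? J) (map ι o′) _)
    (≡.trans (≡.cong₂ _++_ (filter-all (_∈? J) (map-ι∈J o′)) (filter-none (_∈? J) (all-filter (∁? (_∈? J)) (allFin rank))))
             (++-identityʳ (map ι o′))))
    where
    map-ι∈J : ∀ o′ → All (_∈ˢ J) (map ι o′)
    map-ι∈J []       = []
    map-ι∈J (j ∷ o′) = ι∈J j ∷ map-ι∈J o′

  -- Filtering respects permutations, so the letters of o in J permute the image of ι and are
  -- themselves the image of an ordering.
  restrictOrdering : ∀ {o} → o ↭ allFin rank → ∃[ o′ ] filter (_∈? J) o ≡ map ι o′ × allFin W′.rank ↭ o′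
  restrictOrdering o↭ = ↭-map-inv ι (↭-trans (↭-reflexive map-ι-allFin) (filter-↭ (_∈? J) (↭-sym o↭)))

  futuristic-restrict : Futuristic → T′.Futuristic
  futuristic-restrict futuristic c o′ = futuristicElement-restrict o o′ (filter-extendOrdering _) (futuristic _ o)
    where
    o : IsCoxeterElement _
    o = record
      { ordering   = extendOrdering (T′.IsCoxeterElement.ordering o′)
      ; isOrdering = extendOrdering-↭ (T′.IsCoxeterElement.isOrdering o′)
      ; product    = G.refl
      }

  ancient-extend : T′.Ancient → Ancient
  ancient-extend ancient c o futuristic
    with o′ , o≡o′ , o′↭ ← restrictOrdering (IsCoxeterElement.isOrdering o) =
    ancient _ o″ (futuristicElement-restrict o o″ (≡.sym o≡o′) futuristic)
    where
    o″ : T′.IsCoxeterElement (foldl (λ w j → W′.s j W′.∙ w) W′.ε o′)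
    o″ = record { ordering = o′ ; isOrdering = ↭-sym o′↭ ; product = G.refl }

proposition1p12 : (em : ExcludedMiddle 0ℓ) (ℝ : RealField)
    (W : CoxeterSystem) (J : Subset (CoxeterSystem.rank W)) →
    (Toggles.Futuristic em ℝ (CoxeterSystem.markedGroup W) →
    Toggles.Futuristic em ℝ (parabolic W J)) ×
    (Toggles.Ancient em ℝ (parabolic W J) →
    Toggles.Ancient em ℝ (CoxeterSystem.markedGroup W))
proposition1p12 em ℝ W J = futuristic-restrict , ancient-extend
  where open ParabolicSubgroup em ℝ W J
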